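{- Let $R$ be a non-zero subring of $\mathbb Q$ (not necessarily containing $1$) such that there exists an algorithm which, for any given Diophantine equation with integer coefficients, decides whether or not the equation has a solution in $R$. Then the set of all Diophantine equations which have only finitely many solutions in $R$ is recursively enumerable.
   Context: A Diophantine equation is an equation $D(x_1,\ldots,x_n)=0$ with $D\in\mathbb Z[x_1,\ldots,x_n]$ for some $n\ge1$; such equations are regarded as finite objects (e.g. coded by natural numbers), so that recursiveness and recursive enumerability of sets of them make sense. A solution in $R$ means a tuple $(x_1,\ldots,x_n)\in R^n$. A subring of $\mathbb Q$ without $1$ means a non-empty subset closed under addition, negation and multiplication. -}

module Defs where

open import Level using (Level; _⊔_)
open import Data.Nat.Base using (ℕ; zero; suc; _+_; _*_; _<_)
open import Data.Integer.Base using (ℤ; +_; -[1+_])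
import Data.Rational.Base as ℚ
open ℚ using (ℚ; 0ℚ; 1ℚ)
open import Data.Fin.Base using (Fin)
open import Data.List.Base as List using (List; []; _∷_)
open import Data.List.Membership.Propositional using (_∈_)
open import Data.Vec.Base as Vec using (Vec; []; _∷_)
open import Data.Vec.Relation.Unary.All using (All)
open import Data.Vec.Relation.Binary.Pointwise.Inductive using (Pointwise)
open import Data.Product.Base using (Σ; ∃; Σ-syntax; ∃-syntax; _×_; _,_)
open import Data.Sum.Base using (_⊎_)
open import Function.Bundles using (_⇔_)
open import Relation.Nullary.Negation.Core using (¬_)
open import Relation.Unary using (Pred; Satisfiable)
open import Relation.Binary.PropositionalEquality.Core using (_≡_; _≢_)
open import Algebra.Definitions.RawSemiring ℚ.+-*-rawSemiring using (_^_)

private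
  variable
    a ℓ : Level
    A : Set a
    k n : ℕ

------------------------------------------------------------------------
-- Subrings of ℚ, not necessarily containing 1

record IsSubring (R : Pred ℚ ℓ) : Set ℓ where
  field
    nonEmpty : Satisfiable R
    +-closed : ∀ {p q} → R p → R q → R (p ℚ.+ q)
    neg-closed : ∀ {p} → R p → R (ℚ.- p)
    *-closed : ∀ {p q} → R p → R q → R (p ℚ.* q)

NonZeroRing : Pred ℚ ℓ → Set ℓ
NonZeroRing R = ∃[ p ] (R p × p ≢ 0ℚ)

------------------------------------------------------------------------
-- Diophantine equations

-- A term (c , e₁ ∷ … ∷ eₙ ∷ []) stands for c x₁^e₁ ⋯ xₙ^eₙ, and a list of
-- terms for their sum.  Terms may be repeated or have coefficient 0, so a
-- polynomial in ℤ[x₁,…,xₙ] has several presentations.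

Term : ℕ → Set
Term n = ℤ × Vec ℕ n

Polynomial : ℕ → Set
Polynomial n = List (Term n)

evalTerm : Vec ℚ n → Term n → ℚ
evalTerm xs (c , es) =
  (c ℚ./ 1) ℚ.* Vec.foldr (λ _ → ℚ) ℚ._*_ 1ℚ (Vec.zipWith _^_ xs es)

eval : Polynomial n → Vec ℚ n → ℚ
eval D xs = List.foldr ℚ._+_ 0ℚ (List.map (evalTerm xs) D)

-- (m , D) is the equation D(x₁,…,xₘ₊₁) = 0, so there is at least one
-- variable.

Equation : Set
Equation = Σ[ m ∈ ℕ ] Polynomial (suc m)

Solution : Pred ℚ ℓ → (E : Equation) → Pred (Vec ℚ (suc (Σ.proj₁ E))) ℓ
Solution R (m , D) xs = All R xs × eval D xs ≡ 0ℚ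

Solvable : Pred ℚ ℓ → Pred Equation ℓ
Solvable R E = Satisfiable (Solution R E)

Finite : {A : Set a} → Pred A ℓ → Set (a ⊔ ℓ)
Finite {A = A} P = Σ[ xs ∈ List A ] (∀ x → x ∈ xs ⇔ P x)

FinitelyManySolutions : Pred ℚ ℓ → Pred Equation ℓ
FinitelyManySolutions R E = Finite (Solution R E)

------------------------------------------------------------------------
-- Partial recursive functions

data Rec : ℕ → Set where
  zeroᵣ : Rec 0
  sucᵣ  : Rec 1
  projᵣ : Fin n → Rec n
  compᵣ : Rec k → Vec (Rec n) k → Rec n
  precᵣ : Rec n → Rec (2 + n) → Rec (suc n)
  muᵣ   : Rec (suc n) → Rec n

infix 4 _[_]⇓_

-- f [ xs ]⇓ y : the value of f at xs is defined and equal to y.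

data _[_]⇓_ : Rec n → Vec ℕ n → ℕ → Set where
  zero⇓  : zeroᵣ [ [] ]⇓ 0
  suc⇓   : ∀ {x} → sucᵣ [ x ∷ [] ]⇓ suc x
  proj⇓  : ∀ {i : Fin n} {xs} → projᵣ i [ xs ]⇓ Vec.lookup xs i
  comp⇓  : ∀ {f : Rec k} {gs : Vec (Rec n) k} {xs ys z} →
           Pointwise (λ g y → g [ xs ]⇓ y) gs ys →
           f [ ys ]⇓ z →
           compᵣ f gs [ xs ]⇓ z
  precᶻ⇓ : ∀ {f : Rec n} {g xs y} →
           f [ xs ]⇓ y →
           precᵣ f g [ zero ∷ xs ]⇓ y
  precˢ⇓ : ∀ {f : Rec n} {g xs i y z} →
           precᵣ f g [ i ∷ xs ]⇓ y →
           g [ i ∷ y ∷ xs ]⇓ z →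
           precᵣ f g [ suc i ∷ xs ]⇓ z
  mu⇓    : ∀ {f : Rec (suc n)} {xs y} →
           f [ y ∷ xs ]⇓ 0 →
           (∀ i → i < y → ∃[ z ] f [ i ∷ xs ]⇓ suc z) →
           muᵣ f [ xs ]⇓ y

Recursive : Pred ℕ ℓ → Set ℓ
Recursive S = Σ[ f ∈ Rec 1 ] ∀ x →
  (S x × f [ x ∷ [] ]⇓ 1) ⊎ (¬ S x × f [ x ∷ [] ]⇓ 0)

RecursivelyEnumerable : Pred ℕ ℓ → Set ℓ
RecursivelyEnumerable S = Σ[ f ∈ Rec 1 ] ∀ x →
  S x ⇔ (∃[ y ] f [ x ∷ [] ]⇓ y)

------------------------------------------------------------------------
-- Coding of equations by natural numbers

-- Each of the codings below is a bijection onto ℕ.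

triangle : ℕ → ℕ
triangle zero    = 0
triangle (suc n) = suc n + triangle n

-- Cantor's pairing function.

pair : ℕ → ℕ → ℕ
pair x y = triangle (x + y) + y

codeℤ : ℤ → ℕ
codeℤ (+ n)    = 2 * n
codeℤ -[1+ n ] = suc (2 * n)

codeVec : Vec ℕ (suc n) → ℕ
codeVec (e ∷ [])          = e
codeVec (e ∷ es@(_ ∷ _)) = pair e (codeVec es)

codeTerm : Term (suc n) → ℕ
codeTerm (c , es) = pair (codeℤ c) (codeVec es)

codePolynomial : Polynomial (suc n) → ℕ
codePolynomial []      = 0
codePolynomial (t ∷ D) = suc (pair (codeTerm t) (codePolynomial D))

code : Equation → ℕ
code (m , D) = pair m (codePolynomial D)

codes : Pred Equation ℓ → Pred ℕ ℓ
codes S x = ∃[ E ] (code E ≡ x × S E)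

{-# OPTIONS --safe #-}
-- Fix a non-zero integer M in R and enumerate the rationals as q₀, q₁, ….  For t ∈ ℚ, the equation
-- y t = (M² + u² + v²) ((2w + M)² + 7 M²) is solvable in R if and only if t ≠ 0: the right-hand
-- side never vanishes, and up to the factor M⁴ it takes a multiple of every non-zero integer as a
-- value on multiples of M.  Hence “some solution of D = 0 in R has its i-th coordinate outside
-- {q₀, …, q_{N−1}}” is again the solvability in R of a single equation, which can be computed from
-- D, N and i.  There are finitely many solutions if and only if, for some N, these equations are
-- unsolvable for all i, and a search for such an N is a partial recursive function.  Conversely,
-- given N, the solutions are found by filtering a finite box; membership in R is decidable, being
-- the solvability of a linear equation.
module Submission where

open import Level using (Level)
open import Data.Rational.Base using (ℚ)
open import Relation.Unary using (Pred)
open import Defs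

-- The difficulty is to say "t is not 0" by equations in a ring about which almost nothing is known.
-- Over the integers one could ask that t divide some value of (2u - 1)(3v - 1), but if `R` contains
-- 1/2 or 1/3 such a factor has a zero in `R`. The expression divided by t must therefore have no
-- zero in ℚ at all, and yet have zeros modulo every positive integer. Positive definiteness secures
-- the first property. For the second, 1 + u² + v² has zeros modulo every odd number but is never
-- divisible by 4, so a second factor has to supply the powers of 2: (2w + 1)² + 7 = 4(w² + w + 2),
-- where w² + w + 2 has an odd derivative and can be lifted from 2 to every power of 2. Homogenising
-- with `M` is forced because 1 may be missing from `R`. Nor can a finite solution set be recognised
-- by a bound on size, since `R` may be dense in ℚ; this is why coordinates are confined to initial
-- segments of an enumeration.

-- Values of (1 + u² + v²)((2w + 1)² + 7) modulo integers

module NumberTheory where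

  open import Data.Fin.Base as Fin using (Fin; toℕ; fromℕ<; splitAt; join)
  open import Data.Fin.Properties
    using (pigeonhole; toℕ-injective; toℕ≤pred[n]; fromℕ<-injective; join-splitAt; <⇒≢)
  open import Data.Integer.Base hiding (suc) renaming (∣_∣ to abs)
  open import Data.Integer.DivMod using (n%ℕd<d; a≡a%ℕn+[a/ℕn]*n)
  open import Data.Integer.Divisibility.Signed
  open import Data.Integer.Properties hiding (<⇒≢)
  open import Data.Integer.Tactic.RingSolver using (solve-∀)
  open import Data.List.Base using ([]; _∷_)
  open import Data.List.Relation.Unary.All using (All; []; _∷_)
  open import Data.Nat.Base as ℕ using (ℕ; zero; suc)
  open import Data.Nat.Coprimality using (Coprime; coprime-Bézout)
  import Data.Nat.Divisibility as ℕᵈ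
  open import Data.Nat.DivMod using (m≡m%n+[m/n]*n; m%n<n)
  open import Data.Nat.GCD using (module Bézout)
  open import Data.Nat.ListAction using (product)
  open import Data.Nat.Primality
  open import Data.Nat.Primality.Factorisation
  import Data.Nat.Properties as ℕᵖ
  open import Data.Nat.Tactic.RingSolver using () renaming (solve-∀ to solveℕ-∀)
  open import Data.Product.Base using (∃₂; ∃-syntax; _×_; _,_)
  open import Data.Sum.Base using (_⊎_; inj₁; inj₂; [_,_]′)
  open import Function.Base using (_∘_)
  open import Relation.Binary.PropositionalEquality
  open import Relation.Nullary using (¬_; Dec; yes; no; contradiction)

  ∣+∣ : ∀ {d i j} → d ∣ i → d ∣ j → d ∣ i + j
  ∣+∣ = ∣m∣n⇒∣m+n

  ∣-resp : ∀ {d i j} → i ≡ j → d ∣ i → d ∣ j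
  ∣-resp refl d∣i = d∣i

  euclid : ∀ {p} → Prime p → ∀ i j → + p ∣ i * j → + p ∣ i ⊎ + p ∣ j
  euclid {p} pr i j p∣ij with euclidsLemma (abs i) (abs j) pr (subst (p ℕᵈ.∣_) (abs-* i j) (∣⇒∣ᵤ p∣ij))
  ... | inj₁ p∣i = inj₁ (∣ᵤ⇒∣ p∣i)
  ... | inj₂ p∣j = inj₂ (∣ᵤ⇒∣ p∣j)

  ∤⇒coprime : ∀ {p n} → Prime p → ¬ (p ℕᵈ.∣ n) → Coprime p n
  ∤⇒coprime pr p∤n (d∣p , d∣n) with prime⇒irreducible pr d∣p
  ... | inj₁ d≡1  = d≡1
  ... | inj₂ refl = contradiction d∣n p∤n

  -- Bézout over the natural numbers comes with two signs, 1 + y n = x p or 1 + x p = y n; the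
  -- inverse is -y or y accordingly.
  inverseℕ : ∀ {p n} → Prime p → ¬ (p ℕᵈ.∣ n) → ∃[ s ] + p ∣ + n * s - 1ℤ
  inverseℕ {p} {n} pr p∤n with coprime-Bézout (∤⇒coprime pr p∤n)
  ... | Bézout.+- x y eq = - (+ y) , divides (- (+ x)) (begin
    + n * - (+ y) - 1ℤ     ≡⟨ rearrange (+ n) (+ y) ⟩
    - (1ℤ + + y * + n)     ≡⟨ cong -_ (cong (λ z → 1ℤ + z) (pos-* y n)) ⟨
    - (+ (1 ℕ.+ y ℕ.* n))  ≡⟨ cong (λ z → - (+ z)) eq ⟩
    - (+ (x ℕ.* p))        ≡⟨ cong -_ (pos-* x p) ⟩
    - (+ x * + p)          ≡⟨ neg-distribˡ-* (+ x) (+ p) ⟩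
    - (+ x) * + p          ∎)
    where
    open ≡-Reasoning
    rearrange : ∀ n y → n * - y - 1ℤ ≡ - (1ℤ + y * n)
    rearrange = solve-∀
  ... | Bézout.-+ x y eq = + y , divides (+ x) (begin
    + n * + y - 1ℤ            ≡⟨ cong (_- 1ℤ) (*-comm (+ n) (+ y)) ⟩
    + y * + n - 1ℤ            ≡⟨ cong (_- 1ℤ) (pos-* y n) ⟨
    + (y ℕ.* n) - 1ℤ          ≡⟨ cong (λ z → + z - 1ℤ) eq ⟨
    1ℤ + + (x ℕ.* p) - 1ℤ     ≡⟨ cong (λ z → 1ℤ + z - 1ℤ) (pos-* x p) ⟩
    1ℤ + + x * + p - 1ℤ       ≡⟨ rearrange (+ x * + p) ⟩
    + x * + p                 ∎)
    where
    open ≡-Reasoning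
    rearrange : ∀ z → 1ℤ + z - 1ℤ ≡ z
    rearrange = solve-∀

  inverse : ∀ {p} → Prime p → ∀ n → ¬ (+ p ∣ n) → ∃[ s ] + p ∣ n * s - 1ℤ
  inverse pr (+ n) p∤n = inverseℕ pr (p∤n ∘ ∣ᵤ⇒∣)
  inverse pr -[1+ n ] p∤n with inverseℕ pr (p∤n ∘ ∣ᵤ⇒∣)
  ... | s , p∣ = - s , ∣-resp (cong (_- 1ℤ) (flip-sign (+ suc n) s)) p∣
    where
    flip-sign : ∀ n s → n * s ≡ - n * - s
    flip-sign = solve-∀

  -- Both the lifting in `hensel` and the gluing in `crt` reduce to such a congruence.
  linear-congruence : ∀ {p} → Prime p → ∀ n → ¬ (+ p ∣ n) → ∀ c → ∃[ t ] + p ∣ n * t + c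
  linear-congruence pr n p∤n c with inverse pr n p∤n
  ... | s , p∣ = - c * s , ∣-resp (rearrange n c s) (∣n⇒∣m*n (- c) p∣)
    where
    rearrange : ∀ n c s → - c * (n * s - 1ℤ) ≡ n * (- c * s) + c
    rearrange = solve-∀

  odd-prime : ∀ {p} → Prime p → p ≢ 2 → ∃[ k ] p ≡ suc (k ℕ.+ k)
  odd-prime {p} pr p≢2 = go (p ℕ.% 2) (m%n<n p 2) (m≡m%n+[m/n]*n p 2)
    where
    go : ∀ r → r ℕ.< 2 → p ≡ r ℕ.+ p ℕ./ 2 ℕ.* 2 → ∃[ k ] p ≡ suc (k ℕ.+ k)
    go 0 _ eq with prime⇒irreducible pr (ℕᵈ.divides (p ℕ./ 2) eq)
    ... | inj₂ 2≡p = contradiction (sym 2≡p) p≢2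
    go 1 _ eq = p ℕ./ 2 , trans eq (cong suc (double (p ℕ./ 2)))
      where
      double : ∀ k → k ℕ.* 2 ≡ k ℕ.+ k
      double = solveℕ-∀
    go (suc (suc _)) (ℕ.s≤s (ℕ.s≤s ())) _

  mod-≡⇒∣ : ∀ d .{{_ : ℕ.NonZero d}} i j → i %ℕ d ≡ j %ℕ d → + d ∣ i - j
  mod-≡⇒∣ d i j eq = divides (i /ℕ d - j /ℕ d) (begin
    i - j
      ≡⟨ cong₂ _-_ (a≡a%ℕn+[a/ℕn]*n i d) (a≡a%ℕn+[a/ℕn]*n j d) ⟩
    (+ (i %ℕ d) + i /ℕ d * + d) - (+ (j %ℕ d) + j /ℕ d * + d)
      ≡⟨ cong (λ r → (+ r + i /ℕ d * + d) - (+ (j %ℕ d) + j /ℕ d * + d)) eq ⟩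
    (+ (j %ℕ d) + i /ℕ d * + d) - (+ (j %ℕ d) + j /ℕ d * + d)
      ≡⟨ rearrange (+ (j %ℕ d)) (i /ℕ d) (j /ℕ d) (+ d) ⟩
    (i /ℕ d - j /ℕ d) * + d ∎)
    where
    open ≡-Reasoning
    rearrange : ∀ r x y d → (r + x * d) - (r + y * d) ≡ (x - y) * d
    rearrange = solve-∀

  ∣-small : ∀ {p i} → + p ∣ i → abs i ℕ.< p → i ≡ 0ℤ
  ∣-small {p} {i} p∣i i<p with abs i in eq | ∣⇒∣ᵤ p∣i
  ... | zero  | _  = ∣i∣≡0⇒i≡0 eq
  ... | suc _ | p∣ = contradiction p∣ (ℕᵈ.>⇒∤ i<p)

  -- 1 + a² takes k + 1 distinct values modulo p = 2k + 1 as 0 ≤ a ≤ k, and so does −b².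
  module _ {p k : ℕ} (pr : Prime p) (p≡ : p ≡ suc (k ℕ.+ k)) where

    private
      square : Fin (suc k) → ℤ
      square a = + toℕ a * + toℕ a

      -- Since a² - b² = (a - b)(a + b), the prime divides one factor. Both have absolute value at
      -- most a + b ≤ 2k < p, so that factor is 0; and a + b = 0 forces a = b = 0.
      square-injective : ∀ a b → + p ∣ square a - square b → a ≡ b
      square-injective a b p∣ = toℕ-injective
        ([ +-injective ∘ i-j≡0⇒i≡j (+ toℕ a) (+ toℕ b) ∘ small (∣i-j∣≤∣i∣+∣j∣ (+ toℕ a) (+ toℕ b))
         , both-zero ∘ +-injective ∘ small ℕᵖ.≤-refl
         ]′ (euclid pr _ _ (∣-resp (factor (+ toℕ a) (+ toℕ b)) p∣)))
        where
        factor : ∀ a b → a * a - b * b ≡ (a - b) * (a + b)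
        factor = solve-∀
        a+b<p : toℕ a ℕ.+ toℕ b ℕ.< p
        a+b<p = subst (toℕ a ℕ.+ toℕ b ℕ.<_) (sym p≡)
          (ℕ.s≤s (ℕᵖ.+-mono-≤ (toℕ≤pred[n] a) (toℕ≤pred[n] b)))
        small : ∀ {i} → abs i ℕ.≤ toℕ a ℕ.+ toℕ b → + p ∣ i → i ≡ 0ℤ
        small le p∣i = ∣-small p∣i (ℕᵖ.≤-<-trans le a+b<p)
        both-zero : toℕ a ℕ.+ toℕ b ≡ 0 → toℕ a ≡ toℕ b
        both-zero eq = trans (ℕᵖ.m+n≡0⇒m≡0 (toℕ a) eq) (sym (ℕᵖ.m+n≡0⇒n≡0 (toℕ a) eq))

      value : Fin (suc k) ⊎ Fin (suc k) → ℤ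
      value = [ (λ a → 1ℤ + square a) , (λ b → - square b) ]′

      instance
        p-nonZero : ℕ.NonZero p
        p-nonZero = prime⇒nonZero pr

      residue : Fin (suc k ℕ.+ suc k) → Fin p
      residue i = fromℕ< (n%ℕd<d (value (splitAt (suc k) i)) p)

      -- Inside one family a collision contradicts `square-injective`; the two mixed cases say 1 +
      -- a² ≡ -b².
      collision : ∀ (x y : Fin (suc k) ⊎ Fin (suc k)) → x ≢ y → + p ∣ value x - value y →
        ∃₂ λ a b → + p ∣ 1ℤ + a * a + b * b
      collision (inj₁ a) (inj₁ b) x≢y p∣ =
        contradiction (cong inj₁ (square-injective a b (∣-resp (cancel (square a) (square b)) p∣))) x≢y
        where
        cancel : ∀ x y → (1ℤ + x) - (1ℤ + y) ≡ x - y
        cancel = solve-∀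
      collision (inj₂ a) (inj₂ b) x≢y p∣ =
        contradiction
          (cong inj₂ (sym (square-injective b a (∣-resp (swap (square a) (square b)) p∣)))) x≢y
        where
        swap : ∀ x y → - x - (- y) ≡ y - x
        swap = solve-∀
      collision (inj₁ a) (inj₂ b) _ p∣ = + toℕ a , + toℕ b , ∣-resp (eq (square a) (square b)) p∣
        where
        eq : ∀ x y → (1ℤ + x) - (- y) ≡ 1ℤ + x + y
        eq = solve-∀
      collision (inj₂ b) (inj₁ a) _ p∣ =
        + toℕ a , + toℕ b , ∣-resp (eq (square a) (square b)) (∣m⇒∣-m p∣)
        where
        eq : ∀ x y → - (- y - (1ℤ + x)) ≡ 1ℤ + x + y
        eq = solve-∀

    ∣1+a²+b² : ∃₂ λ a b → + p ∣ 1ℤ + a * a + b * b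
    ∣1+a²+b² with pigeonhole p<2+2k residue
      where
      -- The two families together have 2(k + 1) = p + 1 members, one more than there are residues.
      p<2+2k : p ℕ.< suc k ℕ.+ suc k
      p<2+2k = ℕᵖ.≤-reflexive (cong suc (trans p≡ (sym (ℕᵖ.+-suc k k))))
    ... | i , j , i<j , eq =
      collision (splitAt (suc k) i) (splitAt (suc k) j)
        (λ same → <⇒≢ i<j (begin
          i                                       ≡⟨ join-splitAt (suc k) (suc k) i ⟨
          join (suc k) (suc k) (splitAt (suc k) i) ≡⟨ cong (join (suc k) (suc k)) same ⟩
          join (suc k) (suc k) (splitAt (suc k) j) ≡⟨ join-splitAt (suc k) (suc k) j ⟩
          j                                       ∎))
        (mod-≡⇒∣ p (value (splitAt (suc k) i)) (value (splitAt (suc k) j)) (fromℕ<-injective _ _ _ _ eq))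
      where open ≡-Reasoning

  HasPoint : ℤ → Set
  HasPoint n = ∃₂ λ u v → n ∣ 1ℤ + u * u + v * v

  HasPoint-swap : ∀ {n u v} → n ∣ 1ℤ + u * u + v * v → n ∣ 1ℤ + v * v + u * u
  HasPoint-swap {_} {u} {v} = ∣-resp (eq u v)
    where
    eq : ∀ u v → 1ℤ + u * u + v * v ≡ 1ℤ + v * v + u * u
    eq = solve-∀

  ∤1 : ∀ {p} → Prime p → ¬ (+ p ∣ 1ℤ)
  ∤1 pr p∣1 = ℕ.nonTrivial⇒≢1 {{prime⇒nonTrivial pr}} (ℕᵈ.∣1⇒≡1 (∣⇒∣ᵤ p∣1))

  module _ {p : ℕ} (pr : Prime p) (p≢2 : p ≢ 2) (n : ℤ) where

    private
      P = + p

      ∤2 : ¬ (P ∣ + 2)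
      ∤2 p∣2 with prime⇒irreducible prime[2] (∣⇒∣ᵤ p∣2)
      ... | inj₁ refl = ∤1 pr ∣-refl
      ... | inj₂ p≡2  = p≢2 p≡2

      -- If 1 + u² + v² = q n, replacing u by u + n t turns the value into n (2ut + q + n t²). As p
      -- divides n, it remains to solve 2ut + q ≡ 0 modulo p, which is possible because p divides
      -- neither 2 nor u.
      hensel : P ∣ n → ∀ u v → ¬ (P ∣ u) → n ∣ 1ℤ + u * u + v * v → HasPoint (n * P)
      hensel P∣n u v P∤u (divides q eq) =
        adjust (linear-congruence pr (+ 2 * u) ([ ∤2 , P∤u ]′ ∘ euclid pr (+ 2) u) q)
        where
        split : ∀ n q u t → n * ((+ 2 * u * t + q) + n * (t * t)) ≡ q * n + n * (+ 2 * u * t + n * (t * t))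
        split = solve-∀
        collect : ∀ n u v t → (1ℤ + u * u + v * v) + n * (+ 2 * u * t + n * (t * t)) ≡
          1ℤ + (u + n * t) * (u + n * t) + v * v
        collect = solve-∀
        expand : ∀ t → n * ((+ 2 * u * t + q) + n * (t * t)) ≡ 1ℤ + (u + n * t) * (u + n * t) + v * v
        expand t = trans (split n q u t)
          (trans (cong (λ x → x + n * (+ 2 * u * t + n * (t * t))) (sym eq)) (collect n u v t))
        adjust : ∃[ t ] P ∣ + 2 * u * t + q → HasPoint (n * P)
        adjust (t , P∣) = u + n * t , v , ∣-resp (expand t)
          (*-monoʳ-∣ n (∣+∣ P∣ (∣m⇒∣m*n (t * t) P∣n)))

      ∣-*-prime : ∀ {z} → ¬ (P ∣ n) → P ∣ z → n ∣ z → n * P ∣ z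
      ∣-*-prime P∤n P∣z (divides q eq) =
        [ (λ P∣q → ∣-resp (trans (*-comm n q) (sym eq)) (*-monoʳ-∣ n P∣q))
        , (λ P∣n → contradiction P∣n P∤n)
        ]′ (euclid pr q n (∣-resp eq P∣z))

      -- The point (u + n t, v + n s) stays congruent to (u, v) modulo n, and `t` and `s` are chosen
      -- to make it congruent to (a, b) modulo p.
      crt : ¬ (P ∣ n) → ∀ u v a b → n ∣ 1ℤ + u * u + v * v → P ∣ 1ℤ + a * a + b * b → HasPoint (n * P)
      crt P∤n u v a b n∣ P∣ =
        adjust (linear-congruence pr n P∤n (u - a)) (linear-congruence pr n P∤n (v - b))
        where
        shift : ∀ n u v t s → (1ℤ + u * u + v * v) + n * ((u + (u + n * t)) * t + (v + (v + n * s)) * s) ≡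
          1ℤ + (u + n * t) * (u + n * t) + (v + n * s) * (v + n * s)
        shift = solve-∀
        difference : ∀ n u v a b t s →
          (n * t + (u - a)) * (u + n * t + a) + (n * s + (v - b)) * (v + n * s + b) + (1ℤ + a * a + b * b) ≡
          1ℤ + (u + n * t) * (u + n * t) + (v + n * s) * (v + n * s)
        difference = solve-∀
        adjust : ∃[ t ] P ∣ n * t + (u - a) → ∃[ s ] P ∣ n * s + (v - b) → HasPoint (n * P)
        adjust (t , P∣t) (s , P∣s) = u + n * t , v + n * s , ∣-*-prime P∤n
          (∣-resp (difference n u v a b t s) (∣+∣ (∣+∣ (∣m⇒∣m*n _ P∣t) (∣m⇒∣m*n _ P∣s)) P∣))
          (∣-resp (shift n u v t s) (∣+∣ n∣ (∣m⇒∣m*n _ ∣-refl)))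

      -- The conic is smooth modulo p: if p divided both coordinates, it would divide 1 = (1 + u² +
      -- v²) - u² - v². Hence `hensel` always has a coordinate along which to lift.
      both-divide : P ∣ n → ∀ u v → P ∣ u → P ∣ v → n ∣ 1ℤ + u * u + v * v → P ∣ 1ℤ
      both-divide P∣n u v P∣u P∣v n∣ = ∣-resp (isolate u v)
        (∣+∣ (∣+∣ (∣-trans P∣n n∣) (∣m⇒∣-m (∣m⇒∣m*n u P∣u))) (∣m⇒∣-m (∣m⇒∣m*n v P∣v)))
        where
        isolate : ∀ u v → (1ℤ + u * u + v * v) + - (u * u) + - (v * v) ≡ 1ℤ
        isolate = solve-∀

    -- A prime new to `n` is brought in by `crt` from a point modulo p; a prime already in `n` is
    -- handled by `hensel`, after swapping coordinates if p divides `u`.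
    HasPoint-* : HasPoint n → HasPoint (n * P)
    HasPoint-* (u , v , n∣) = go (P ∣? n) (P ∣? u) (P ∣? v)
      where
      go : Dec (P ∣ n) → Dec (P ∣ u) → Dec (P ∣ v) → HasPoint (n * P)
      go (no P∤n) _ _ =
        let k , p≡ = odd-prime pr p≢2
            a , b , P∣ = ∣1+a²+b² {k = k} pr p≡
        in crt P∤n u v a b n∣ P∣
      go (yes P∣n) (no P∤u) _ = hensel P∣n u v P∤u n∣
      go (yes P∣n) (yes _) (no P∤v) = hensel P∣n v u P∤v (HasPoint-swap {n} {u} {v} n∣)
      go (yes P∣n) (yes P∣u) (yes P∣v) =
        contradiction (both-divide P∣n u v P∣u P∣v n∣) (∤1 pr)

  2^ : ℕ → ℤ
  2^ zero    = 1ℤ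
  2^ (suc e) = 2^ e * + 2

  parity : ∀ n → ∃[ k ] (n ≡ k * + 2 ⊎ n ≡ k * + 2 + 1ℤ)
  parity n = go (n %ℕ 2) (n%ℕd<d n 2) (a≡a%ℕn+[a/ℕn]*n n 2)
    where
    go : ∀ r → r ℕ.< 2 → n ≡ + r + n /ℕ 2 * + 2 → ∃[ k ] (n ≡ k * + 2 ⊎ n ≡ k * + 2 + 1ℤ)
    go 0 _ eq = n /ℕ 2 , inj₁ (trans eq (+-identityˡ _))
    go 1 _ eq = n /ℕ 2 , inj₂ (trans eq (+-comm 1ℤ (n /ℕ 2 * + 2)))
    go (suc (suc _)) (ℕ.s≤s (ℕ.s≤s ())) _

  -- Adding x to w changes w² + w + 2 by x (2w + 1 + x). For x = 2^e with e ≥ 1 the bracket is odd,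
  -- so an odd quotient by x becomes even. For x = 1 the bracket is even, so exponent 1 needs its
  -- own base case.
  2^∣w²+w+2 : ∀ e → ∃[ w ] 2^ e ∣ w * w + w + + 2
  2^∣w²+w+2 zero          = 0ℤ , divides (+ 2) refl
  2^∣w²+w+2 (suc zero)    = 0ℤ , divides 1ℤ refl
  2^∣w²+w+2 (suc (suc e)) with 2^∣w²+w+2 (suc e)
  ... | w , divides q eq with parity q
  ...   | k , inj₁ refl = w , divides k (trans eq (assoc k (2^ e)))
    where
    assoc : ∀ k x → k * + 2 * (x * + 2) ≡ k * (x * + 2 * + 2)
    assoc = solve-∀
  ...   | k , inj₂ refl = w + 2^ (suc e) , divides (k + w + 1ℤ + 2^ e) (begin
    (w + x) * (w + x) + (w + x) + + 2            ≡⟨ expand w x ⟩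
    (w * w + w + + 2) + x * (+ 2 * w + 1ℤ + x)   ≡⟨ cong (_+ x * (+ 2 * w + 1ℤ + x)) eq ⟩
    (k * + 2 + 1ℤ) * x + x * (+ 2 * w + 1ℤ + x)  ≡⟨ collect k w (2^ e) ⟩
    (k + w + 1ℤ + 2^ e) * (x * + 2)              ∎)
    where
    open ≡-Reasoning
    x = 2^ (suc e)
    expand : ∀ w x → (w + x) * (w + x) + (w + x) + + 2 ≡ (w * w + w + + 2) + x * (+ 2 * w + 1ℤ + x)
    expand = solve-∀
    collect : ∀ k w y → (k * + 2 + 1ℤ) * (y * + 2) + (y * + 2) * (+ 2 * w + 1ℤ + y * + 2) ≡
      (k + w + 1ℤ + y) * (y * + 2 * + 2)
    collect = solve-∀

  -- Factors 2 are kept out of `n`: squares are 0 or 1 modulo 4, so 1 + u² + v² is never divisible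
  -- by 4.
  splitting : ∀ {ps} → All Prime ps → ∃₂ λ e n → + product ps ≡ 2^ e * n × HasPoint n
  splitting [] = 0 , 1ℤ , refl , 0ℤ , 0ℤ , ∣-refl
  splitting {p ∷ ps} (pr ∷ prs) with splitting prs | p ℕᵖ.≟ 2
  ... | e , n , eq , point | yes refl =
    suc e , n , trans (pos-* 2 (product ps)) (trans (cong (+ 2 *_) eq) (rearrange (2^ e) n)) , point
    where
    rearrange : ∀ x n → + 2 * (x * n) ≡ x * + 2 * n
    rearrange = solve-∀
  ... | e , n , eq , point | no p≢2 =
    e , n * + p , trans (pos-* p (product ps)) (trans (cong (+ p *_) eq) (rearrange (+ p) (2^ e) n))
    , HasPoint-* pr p≢2 n point
    where
    rearrange : ∀ p x n → p * (x * n) ≡ x * (n * p)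
    rearrange = solve-∀

  -- The first factor absorbs the odd part of n and the second one its power of 2:
  -- the conic 1 + u² + v² = 0 has p-adic points for all odd p, and −7 is a 2-adic square.
  multiple-of-form : ∀ n .{{_ : ℕ.NonZero n}} → ∃₂ λ u v → ∃₂ λ w l →
    + n * l ≡ (1ℤ + u * u + v * v) * ((w + w + 1ℤ) * (w + w + 1ℤ) + + 7)
  multiple-of-form n with factorise n
  ... | record { isFactorisation = refl ; factorsPrime = prs } with splitting prs
  ...   | e , n′ , eq , u , v , divides q eq₁ with 2^∣w²+w+2 e
  ...     | w , divides r eq₂ = u , v , w , q * r * + 4 , (begin
    + n * (q * r * + 4)                      ≡⟨ cong (_* (q * r * + 4)) eq ⟩
    (2^ e * n′) * (q * r * + 4)              ≡⟨ regroup (2^ e) n′ q r ⟩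
    (q * n′) * ((r * 2^ e) * + 4)            ≡⟨ cong₂ (λ x y → x * (y * + 4)) eq₁ eq₂ ⟨
    (1ℤ + u * u + v * v) * ((w * w + w + + 2) * + 4)
                                             ≡⟨ cong ((1ℤ + u * u + v * v) *_) (complete w) ⟩
    (1ℤ + u * u + v * v) * ((w + w + 1ℤ) * (w + w + 1ℤ) + + 7) ∎)
    where
    open ≡-Reasoning
    regroup : ∀ x n q r → (x * n) * (q * r * + 4) ≡ (q * n) * ((r * x) * + 4)
    regroup = solve-∀
    complete : ∀ w → (w * w + w + + 2) * + 4 ≡ (w + w + 1ℤ) * (w + w + 1ℤ) + + 7
    complete = solve-∀

  multiple-of-form-ℤ : ∀ a → a ≢ 0ℤ → ∃₂ λ u v → ∃₂ λ w l →
    a * l ≡ (1ℤ + u * u + v * v) * ((w + w + 1ℤ) * (w + w + 1ℤ) + + 7)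
  multiple-of-form-ℤ (+ zero)    a≢0 = contradiction refl a≢0
  multiple-of-form-ℤ (+ suc n)   _   = multiple-of-form (suc n)
  multiple-of-form-ℤ -[1+ n ]    _   with multiple-of-form (suc n)
  ... | u , v , w , l , eq = u , v , w , - l , trans (flip-sign (+ suc n) l) eq
    where
    flip-sign : ∀ n l → - n * - l ≡ n * l
    flip-sign = solve-∀

-- Closure properties of recursive functions, and inversion of the pairing function

module Computability where

  open import Data.Fin.Base using (Fin; zero; suc)
  open import Data.Fin using (#_)
  open import Data.Nat.Base
  open import Data.Nat.Properties
  open import Data.Product.Base using (∃-syntax; _,_)
  open import Data.Vec.Base using (Vec; []; _∷_; lookup; tabulate; tail)
  open import Data.Vec.Properties using (tabulate∘lookup)
  open import Data.Vec.Relation.Binary.Pointwise.Inductive using (Pointwise; []; _∷_; tabulate⁺)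
  open import Relation.Binary.Definitions using (tri<; tri≈; tri>)
  open import Relation.Binary.PropositionalEquality

  -- This leads from a run back to the function computed: a derivation that `program testᶜ` yields 0
  -- forces `test` to be 0 there. For `muᵣ`, the smaller of two results would have both value 0 and
  -- a successor value.
  ⇓-deterministic : ∀ {n} {f : Rec n} {xs y z} → f [ xs ]⇓ y → f [ xs ]⇓ z → y ≡ z
  ⇓-deterministic* : ∀ {n k} {gs : Vec (Rec n) k} {xs ys zs} →
    Pointwise (λ g y → g [ xs ]⇓ y) gs ys → Pointwise (λ g y → g [ xs ]⇓ y) gs zs → ys ≡ zs

  ⇓-deterministic zero⇓ zero⇓ = refl
  ⇓-deterministic suc⇓ suc⇓ = refl
  ⇓-deterministic proj⇓ proj⇓ = refl
  ⇓-deterministic (comp⇓ gs f) (comp⇓ gs′ f′) with ⇓-deterministic* gs gs′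
  ... | refl = ⇓-deterministic f f′
  ⇓-deterministic (precᶻ⇓ f) (precᶻ⇓ f′) = ⇓-deterministic f f′
  ⇓-deterministic (precˢ⇓ f g) (precˢ⇓ f′ g′) with ⇓-deterministic f f′
  ... | refl = ⇓-deterministic g g′
  ⇓-deterministic (mu⇓ {y = y} f below) (mu⇓ {y = z} f′ below′) with <-cmp y z
  ... | tri≈ _ y≡z _ = y≡z
  ... | tri< y<z _ _ with below′ y y<z
  ...   | _ , g with ⇓-deterministic f g
  ...     | ()
  ⇓-deterministic (mu⇓ {y = y} f below) (mu⇓ {y = z} f′ below′) | tri> _ _ z<y with below z z<y
  ...   | _ , g with ⇓-deterministic f′ g
  ...     | ()

  ⇓-deterministic* [] [] = refl
  ⇓-deterministic* (g ∷ gs) (g′ ∷ gs′) = cong₂ _∷_ (⇓-deterministic g g′) (⇓-deterministic* gs gs′)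

  -- Functions remain ordinary Agda functions, about which equations are easily proved; the program
  -- is carried along as evidence.
  record Computable {n} (F : Vec ℕ n → ℕ) : Set where
    constructor computedBy
    field
      program : Rec n
      correct : ∀ xs → program [ xs ]⇓ F xs
  open Computable public

  record Substitution {n k} (σ : Vec ℕ n → Vec ℕ k) : Set where
    constructor computedBy
    field
      programs : Vec (Rec n) k
      corrects : ∀ xs → Pointwise (λ g y → g [ xs ]⇓ y) programs (σ xs)
  open Substitution

  private
    variable
      k n : ℕ
      F G K : Vec ℕ n → ℕ
      σ : Vec ℕ n → Vec ℕ k

  ≗-computable : Computable F → F ≗ G → Computable G
  ≗-computable (computedBy f f⇓) F≗G =
    computedBy f (λ xs → subst (f [ xs ]⇓_) (F≗G xs) (f⇓ xs))

  []ˢ : Substitution {n} (λ _ → [])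
  []ˢ = computedBy [] (λ _ → [])

  infixr 5 _∷ˢ_

  _∷ˢ_ : Computable F → Substitution σ → Substitution (λ xs → F xs ∷ σ xs)
  computedBy f f⇓ ∷ˢ computedBy fs fs⇓ = computedBy (f ∷ fs) (λ xs → f⇓ xs ∷ fs⇓ xs)

  idˢ : Substitution {n} (λ xs → xs)
  idˢ = computedBy (tabulate projᵣ) (λ xs →
    subst (Pointwise _ _) (tabulate∘lookup xs) (tabulate⁺ (λ _ → proj⇓)))

  weakenˢ : Substitution {suc n} tail
  weakenˢ = computedBy (tabulate (λ i → projᵣ (suc i))) λ where
    (x ∷ xs) → subst (Pointwise _ _) (tabulate∘lookup xs) (tabulate⁺ (λ _ → proj⇓))

  _[_]ᶜ : Computable F → Substitution σ → Computable (λ xs → F (σ xs))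
  computedBy f f⇓ [ computedBy gs gs⇓ ]ᶜ =
    computedBy (compᵣ f gs) (λ xs → comp⇓ (gs⇓ xs) (f⇓ _))

  _↑ : Computable F → Computable (λ xs → F (tail xs))
  f ↑ = f [ weakenˢ ]ᶜ

  _∘ˢ_ : ∀ {l} {τ : Vec ℕ k → Vec ℕ l} → Substitution τ → Substitution σ →
    Substitution (λ xs → τ (σ xs))
  _∘ˢ_ {k = k} {σ = σ} (computedBy fs fs⇓) gs = computedBy (go fs) (λ xs → go⇓ fs xs (fs⇓ (σ xs)))
    where
    go : ∀ {l} → Vec (Rec k) l → Vec (Rec _) l
    go []       = []
    go (f ∷ fs) = compᵣ f (programs gs) ∷ go fs
    go⇓ : ∀ {l} (fs : Vec (Rec k) l) xs {ys : Vec ℕ l} → Pointwise (λ f y → f [ σ xs ]⇓ y) fs ys →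
      Pointwise (λ f y → f [ xs ]⇓ y) (go fs) ys
    go⇓ []       xs []          = []
    go⇓ (f ∷ fs) xs (f⇓ ∷ fs⇓) = comp⇓ (corrects gs xs) f⇓ ∷ go⇓ fs xs fs⇓

  varᶜ : (i : Fin n) → Computable (λ xs → lookup xs i)
  varᶜ i = computedBy (projᵣ i) (λ _ → proj⇓)

  sucᶜ : Computable F → Computable (λ xs → suc (F xs))
  sucᶜ (computedBy f f⇓) = computedBy (compᵣ sucᵣ (f ∷ [])) (λ xs → comp⇓ (f⇓ xs ∷ []) suc⇓)

  constᶜ : ∀ c → Computable {n} (λ _ → c)
  constᶜ zero    = computedBy (compᵣ zeroᵣ []) (λ _ → comp⇓ [] zero⇓)
  constᶜ (suc c) = sucᶜ (constᶜ c)

  -- The arbitrary type `A` makes `linearsP`, `linearsℂ` and `linears` one and the same recursion,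
  -- on polynomials, codes and rationals, so that comparing them is a plain induction.
  primrec : ∀ {a} {A : Set a} → A → (ℕ → A → A) → ℕ → A
  primrec b s zero    = b
  primrec b s (suc k) = s k (primrec b s k)

  primrecᶜ : ∀ {S : Vec ℕ (2 + n) → ℕ} → Computable F → Computable S → Computable K →
    Computable (λ xs → primrec (F xs) (λ i r → S (i ∷ r ∷ xs)) (K xs))
  primrecᶜ {F = F} {K = K} {S = S} (computedBy f f⇓) (computedBy s s⇓) k =
    computedBy (precᵣ f s) prec-correct [ k ∷ˢ idˢ ]ᶜ
    where
    prec-correct : ∀ xs → precᵣ f s [ xs ]⇓ primrec (F (tail xs)) (λ i r → S (i ∷ r ∷ tail xs)) (lookup xs (# 0))
    prec-correct (zero  ∷ xs) = precᶻ⇓ (f⇓ xs)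
    prec-correct (suc i ∷ xs) = precˢ⇓ (prec-correct (i ∷ xs)) (s⇓ _)

  infix 8 _↑
  infixl 6 _+ᶜ_ _∸ᶜ_
  infixl 7 _*ᶜ_

  abstract
    _+ᶜ_ : Computable F → Computable G → Computable (λ xs → F xs + G xs)
    _+ᶜ_ {F = F} {G = G} f g =
      ≗-computable (primrecᶜ g (sucᶜ (varᶜ (# 1))) f) (λ xs → go (G xs) (F xs))
      where
      go : ∀ b k → primrec b (λ _ r → suc r) k ≡ k + b
      go b zero    = refl
      go b (suc k) = cong suc (go b k)

    _*ᶜ_ : Computable F → Computable G → Computable (λ xs → F xs * G xs)
    _*ᶜ_ {F = F} {G = G} f g =
      ≗-computable (primrecᶜ (constᶜ 0) (g ↑ ↑ +ᶜ varᶜ (# 1)) f)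
        (λ xs → go (G xs) (F xs))
      where
      go : ∀ b k → primrec 0 (λ _ r → b + r) k ≡ k * b
      go b zero    = refl
      go b (suc k) = cong (b +_) (go b k)

    _∸ᶜ_ : Computable F → Computable G → Computable (λ xs → F xs ∸ G xs)
    _∸ᶜ_ {F = F} {G = G} f g =
      ≗-computable (primrecᶜ f (predᶜ (varᶜ (# 1))) g) (λ xs → go (F xs) (G xs))
      where
      predᶜ : ∀ {n} {F : Vec ℕ n → ℕ} → Computable F → Computable (λ xs → pred (F xs))
      predᶜ {F = F} f = ≗-computable (primrecᶜ (constᶜ 0) (varᶜ (# 0)) f) (λ xs → go (F xs))
        where
        go : ∀ k → primrec 0 (λ i _ → i) k ≡ pred k
        go zero    = refl
        go (suc k) = refl
      go : ∀ b k → primrec b (λ _ r → pred r) k ≡ b ∸ k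
      go b zero    = refl
      go b (suc k) = trans (cong pred (go b k)) (pred[m∸n]≡m∸[1+n] b k)

  if0 : ℕ → ℕ → ℕ → ℕ
  if0 c a b = primrec a (λ _ _ → b) c

  abstract
    if0ᶜ : Computable K → Computable F → Computable G → Computable (λ xs → if0 (K xs) (F xs) (G xs))
    if0ᶜ k f g = primrecᶜ f (g ↑ ↑) k

  -- Kronecker's delta: the sum of the two truncated differences is |a - b|.
  δ : ℕ → ℕ → ℕ
  δ a b = 1 ∸ ((a ∸ b) + (b ∸ a))

  δᶜ : Computable F → Computable G → Computable (λ xs → δ (F xs) (G xs))
  δᶜ f g = constᶜ 1 ∸ᶜ (f ∸ᶜ g +ᶜ (g ∸ᶜ f))

  δ-refl : ∀ a → δ a a ≡ 1
  δ-refl a rewrite n∸n≡0 a = refl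

  δ-< : ∀ {a b} → a < b → δ a b ≡ 0
  δ-< {a} {b} a<b = m≤n⇒m∸n≡0 (≤-trans (m<n⇒0<n∸m a<b) (m≤n+m (b ∸ a) (a ∸ b)))

  δ-> : ∀ {a b} → b < a → δ a b ≡ 0
  δ-> {a} {b} b<a = m≤n⇒m∸n≡0 (≤-trans (m<n⇒0<n∸m b<a) (m≤m+n (a ∸ b) (b ∸ a)))

  abstract
    triangleᶜ : Computable F → Computable (λ xs → triangle (F xs))
    triangleᶜ {F = F} f =
      ≗-computable (primrecᶜ (constᶜ 0) (sucᶜ (varᶜ (# 0)) +ᶜ varᶜ (# 1)) f) (λ xs → go (F xs))
      where
      go : ∀ k → primrec 0 (λ i r → suc i + r) k ≡ triangle k
      go zero    = refl
      go (suc k) = cong (suc k +_) (go k)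

  -- A copy of pair for the computability proofs: unfolding pair blows up unification.
  opaque
    ⟪_,_⟫ : ℕ → ℕ → ℕ
    ⟪ x , y ⟫ = pair x y

    pairᶜ : Computable F → Computable G → Computable (λ xs → ⟪ F xs , G xs ⟫)
    pairᶜ f g = triangleᶜ (f +ᶜ g) +ᶜ g

  -- The index of the largest triangular number not exceeding the argument: it grows by 1 exactly
  -- when the argument reaches the next triangular number.
  triangular-root : ℕ → ℕ
  triangular-root = primrec 0 (λ i r → r + δ (suc i) (triangle (suc r)))

  private
    next-triangle : ∀ {s y} → y < s → suc (triangle s + y) < suc s + triangle s
    next-triangle {s} {y} y<s = s≤s (begin
      suc (triangle s + y)  ≡⟨ +-suc (triangle s) y ⟨
      triangle s + suc y    ≤⟨ +-monoʳ-≤ (triangle s) y<s ⟩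
      triangle s + s        ≡⟨ +-comm (triangle s) s ⟩
      s + triangle s        ∎)
      where open ≤-Reasoning

  -- The induction walks back along Cantor's diagonals: the predecessor of position `suc y` is `y`
  -- on the same diagonal, and the predecessor of position 0 on diagonal `suc s` is the last
  -- position `s` of diagonal `s`. Only there does the root jump.
  triangular-root-correct : ∀ {s y} → y ≤ s → triangular-root (triangle s + y) ≡ s
  triangular-root-correct {zero}  {zero} _ = refl
  triangular-root-correct {suc s} {zero} _
    rewrite +-identityʳ (s + triangle s) | +-comm s (triangle s)
          | triangular-root-correct (≤-refl {s})
          | +-comm (triangle s) s | δ-refl (s + triangle s) = +-comm s 1
  triangular-root-correct {s} {suc y} y<s
    rewrite +-suc (triangle s) y | triangular-root-correct (<⇒≤ y<s)
          | δ-< {suc (triangle s + y)} {suc s + triangle s} (next-triangle y<s) = +-identityʳ s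

  private
    triangular-root-pair : ∀ x y → triangular-root (pair x y) ≡ x + y
    triangular-root-pair x y = triangular-root-correct (m≤n+m y x)

    rootᶜ : Computable F → Computable (λ xs → triangular-root (F xs))
    rootᶜ f = primrecᶜ (constᶜ 0)
      (varᶜ (# 1) +ᶜ δᶜ (sucᶜ (varᶜ (# 0))) (triangleᶜ (sucᶜ (varᶜ (# 1))))) f

  abstract
    π₁ π₂ : ℕ → ℕ
    π₂ z = z ∸ triangle (triangular-root z)
    π₁ z = triangular-root z ∸ π₂ z

    π₂-pair : ∀ x y → π₂ (pair x y) ≡ y
    π₂-pair x y rewrite triangular-root-pair x y = m+n∸m≡n (triangle (x + y)) y

    π₁-pair : ∀ x y → π₁ (pair x y) ≡ x
    π₁-pair x y rewrite π₂-pair x y | triangular-root-pair x y = m+n∸n≡m x y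

    π₂ᶜ : Computable F → Computable (λ xs → π₂ (F xs))
    π₂ᶜ f = f ∸ᶜ triangleᶜ (rootᶜ f)

    π₁ᶜ : Computable F → Computable (λ xs → π₁ (F xs))
    π₁ᶜ f = rootᶜ f ∸ᶜ π₂ᶜ f

  -- Successors follow the diagonals: (x + 1, y) is followed by (x, y + 1), and the end (0, y) of a
  -- diagonal by (y + 1, 0).
  pair-surjective : ∀ z → ∃[ x ] ∃[ y ] pair x y ≡ z
  pair-surjective zero = 0 , 0 , refl
  pair-surjective (suc z) with pair-surjective z
  ... | zero  , y , refl = suc y , 0 , (begin
    triangle (suc y + 0) + 0  ≡⟨ +-identityʳ _ ⟩
    triangle (suc y + 0)      ≡⟨ cong triangle (+-identityʳ (suc y)) ⟩
    suc (y + triangle y)      ≡⟨ cong suc (+-comm y (triangle y)) ⟩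
    suc (triangle y + y)      ∎)
    where open ≡-Reasoning
  ... | suc x , y , refl = x , suc y , (begin
    triangle (x + suc y) + suc y    ≡⟨ cong (λ s → triangle s + suc y) (+-suc x y) ⟩
    triangle (suc x + y) + suc y    ≡⟨ +-suc _ y ⟩
    suc (triangle (suc x + y) + y)  ∎)
    where open ≡-Reasoning

-- Integers, exponent vectors and lists handled through their codes

module Coding where

  open import Data.Fin.Base using (zero; suc; toℕ)
  open import Data.Integer.Base as ℤ using (ℤ; +_; -[1+_])
  import Data.Integer.Properties as ℤ
  open import Data.List.Base using ([]; _∷_; foldl; length)
  open import Data.Nat.Base hiding (parity)
  open import Data.Nat.Properties
  open import Data.Product.Base using (_,_)
  open import Data.Vec.Base using (Vec; []; _∷_; lookup; tabulate)
  open import Data.Vec.Properties using (tabulate-cong)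
  open import Function.Base using (_∘_)
  open import Relation.Binary.PropositionalEquality
  open Computability

  private
    variable
      m n : ℕ

  parity half : ℕ → ℕ
  parity = primrec 0 (λ _ r → 1 ∸ r)
  half = primrec 0 (λ i r → r + parity i)

  parity-double : ∀ n → parity (n + n) ≡ 0
  parity-double zero = refl
  parity-double (suc n) rewrite +-suc n n | parity-double n = refl

  half-double : ∀ n → half (n + n) ≡ n
  half-double zero = refl
  half-double (suc n) rewrite +-suc n n | parity-double n | half-double n =
    trans (cong (_+ 1) (+-identityʳ n)) (+-comm n 1)

  -- On the code of an integer this is the absolute value, and `parity` is the sign bit: `-[1+ n ]`
  -- has code 2n + 1 and absolute value n + 1.
  magnitude : ℕ → ℕ
  magnitude z = half z + parity z

  -- A negative integer -k has code 2k - 1. Truncated subtraction makes this correct for k = 0 too,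
  -- so a zero product needs no separate case. The outer `parity` adds the sign bits modulo 2.
  mulℤ : ℕ → ℕ → ℕ
  mulℤ a b = 2 * (magnitude a * magnitude b) ∸ parity (parity a + parity b)

  parity-+ : ∀ n → parity (codeℤ (+ n)) ≡ 0
  parity-+ n rewrite +-identityʳ n = parity-double n

  magnitude-+ : ∀ n → magnitude (codeℤ (+ n)) ≡ n
  magnitude-+ n rewrite +-identityʳ n | parity-double n | half-double n = +-identityʳ n

  parity-- : ∀ n → parity (codeℤ -[1+ n ]) ≡ 1
  parity-- n rewrite parity-+ n = refl

  magnitude-- : ∀ n → magnitude (codeℤ -[1+ n ]) ≡ suc n
  magnitude-- n rewrite +-identityʳ n | parity-double n | half-double n =
    trans (cong (_+ 1) (+-identityʳ n)) (+-comm n 1)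

  codeℤ-neg : ∀ n → codeℤ (ℤ.- (+ n)) ≡ 2 * n ∸ 1
  codeℤ-neg zero    = refl
  codeℤ-neg (suc n) = sym (+-suc n (n + 0))

  mulℤ-via : ∀ a b {x y p q} → magnitude a ≡ x → magnitude b ≡ y → parity a ≡ p → parity b ≡ q →
    mulℤ a b ≡ 2 * (x * y) ∸ parity (p + q)
  mulℤ-via _ _ refl refl refl refl = refl

  mulℤ-correct : ∀ c d → mulℤ (codeℤ c) (codeℤ d) ≡ codeℤ (c ℤ.* d)
  mulℤ-correct (+ m) (+ n) =
    trans (mulℤ-via (codeℤ (+ m)) (codeℤ (+ n)) (magnitude-+ m) (magnitude-+ n) (parity-+ m) (parity-+ n))
      (cong codeℤ (ℤ.pos-* m n))
  mulℤ-correct (+ m) -[1+ n ] =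
    trans (mulℤ-via (codeℤ (+ m)) (codeℤ -[1+ n ]) (magnitude-+ m) (magnitude-- n) (parity-+ m) (parity-- n))
      (trans (sym (codeℤ-neg (m * suc n)))
        (cong codeℤ (trans (cong ℤ.-_ (ℤ.pos-* m (suc n))) (ℤ.neg-distribʳ-* (+ m) (+ suc n)))))
  mulℤ-correct -[1+ m ] (+ n) =
    trans (mulℤ-via (codeℤ -[1+ m ]) (codeℤ (+ n)) (magnitude-- m) (magnitude-+ n) (parity-- m) (parity-+ n))
      (trans (sym (codeℤ-neg (suc m * n)))
        (cong codeℤ (trans (cong ℤ.-_ (ℤ.pos-* (suc m) n)) (ℤ.neg-distribˡ-* (+ suc m) (+ n)))))
  mulℤ-correct -[1+ m ] -[1+ n ] =
    mulℤ-via (codeℤ -[1+ m ]) (codeℤ -[1+ n ]) (magnitude-- m) (magnitude-- n) (parity-- m) (parity-- n)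

  -- The last of the `m + 1` entries is coded bare, without a pair around it; the test `m ∸ i`
  -- recognises it.
  component : ℕ → ℕ → ℕ → ℕ
  component m v i = if0 (m ∸ i) (primrec v (λ _ → π₂) i) (π₁ (primrec v (λ _ → π₂) i))

  primrec-shift : ∀ {A : Set} (f : A → A) b k → primrec b (λ _ → f) (suc k) ≡ primrec (f b) (λ _ → f) k
  primrec-shift f b zero    = refl
  primrec-shift f b (suc k) = cong f (primrec-shift f b k)

  component-correct : ∀ (es : Vec ℕ (suc m)) i → component m (codeVec es) (toℕ i) ≡ lookup es i
  component-correct (e ∷ [])     zero    = refl
  component-correct (e ∷ f ∷ es) zero    = π₁-pair e (codeVec (f ∷ es))
  component-correct (e ∷ f ∷ es) (suc i)
    rewrite primrec-shift π₂ (pair e (codeVec (f ∷ es))) (toℕ i) | π₂-pair e (codeVec (f ∷ es)) =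
    component-correct (f ∷ es) i

  -- Nested pairs are built from the inside, so the recursion starts at the last entry `φ m` and
  -- descends to `φ 0`.
  tabulateℂ : ℕ → (ℕ → ℕ) → ℕ
  tabulateℂ m φ = primrec (φ m) (λ j r → ⟪ φ (m ∸ suc j) , r ⟫) m

  opaque
    unfolding ⟪_,_⟫

    tabulateℂ-correct : ∀ m φ → tabulateℂ m φ ≡ codeVec (tabulate {n = suc m} (φ ∘ toℕ))
    tabulateℂ-correct m φ = trans (go m ≤-refl)
      (cong (codeVec {m}) (tabulate-cong (λ i → cong (λ d → φ (d + toℕ i)) (n∸n≡0 m))))
      where
      -- After `k` steps the value codes the entries with indices from m - k to m.
      go : ∀ k → k ≤ m → primrec (φ m) (λ j r → pair (φ (m ∸ suc j)) r) k ≡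
        codeVec (tabulate {n = suc k} (λ i → φ (m ∸ k + toℕ i)))
      go zero    _   = cong φ (sym (+-identityʳ m))
      go (suc k) k<m = cong₂ pair (cong φ (sym (+-identityʳ (m ∸ suc k))))
        (trans (go k (<⇒≤ k<m)) (cong (codeVec {k}) (tabulate-cong (λ i → cong φ (begin
          m ∸ k + toℕ i              ≡⟨ cong (_+ toℕ i) (∸-suc k<m) ⟨
          suc (m ∸ suc k) + toℕ i    ≡⟨ +-suc (m ∸ suc k) (toℕ i) ⟨
          m ∸ suc k + suc (toℕ i)    ∎)))))
        where
        open ≡-Reasoning
        ∸-suc : ∀ {k m} → k < m → suc (m ∸ suc k) ≡ m ∸ k
        ∸-suc {zero}  (s≤s _)   = refl
        ∸-suc {suc k} (s≤s k<m) = ∸-suc k<m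

  foldStep : (ℕ → ℕ → ℕ) → ℕ → ℕ
  foldStep S s = if0 (π₂ s) s ⟪ S (π₁ s) (π₁ (π₂ s ∸ 1)) , π₂ (π₂ s ∸ 1) ⟫

  -- The state pairs the accumulator with the rest of the list; the code of a list bounds its
  -- length, and further steps do nothing.
  foldℂ : (ℕ → ℕ → ℕ) → ℕ → ℕ → ℕ
  foldℂ S a l = π₁ (primrec ⟪ a , l ⟫ (λ _ → foldStep S) l)

  length≤code : ∀ (ts : Polynomial (suc m)) → length ts ≤ codePolynomial ts
  length≤code []       = z≤n
  length≤code (t ∷ ts) = s≤s (≤-trans (length≤code ts) (m≤n+m _ _))

  opaque
    unfolding ⟪_,_⟫

    foldℂ-foldl : ∀ S a (ts : Polynomial (suc m)) →
      foldℂ S a (codePolynomial ts) ≡ foldl (λ acc t → S acc (codeTerm t)) a ts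
    foldℂ-foldl S a ts = trans (cong π₁ (run (codePolynomial ts) a ts (length≤code ts)))
      (π₁-pair (foldl (λ acc t → S acc (codeTerm t)) a ts) 0)
      where
      halted : ∀ k a → primrec (pair a 0) (λ _ → foldStep S) k ≡ pair a 0
      halted zero    a = refl
      halted (suc k) a rewrite halted k a | π₂-pair a 0 = refl
      step : ∀ a t r → foldStep S (pair a (suc (pair t r))) ≡ pair (S a t) r
      step a t r = trans
        (cong₂ (λ x l → if0 l (pair a (suc (pair t r))) (pair (S x (π₁ (l ∸ 1))) (π₂ (l ∸ 1))))
          (π₁-pair a (suc (pair t r))) (π₂-pair a (suc (pair t r))))
        (cong₂ (λ y r → pair (S a y) r) (π₁-pair t r) (π₂-pair t r))
      run : ∀ k a (ts : Polynomial (suc m)) → length ts ≤ k →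
        primrec (pair a (codePolynomial ts)) (λ _ → foldStep S) k ≡
        pair (foldl (λ acc t → S acc (codeTerm t)) a ts) 0
      run k       a []       _       = halted k a
      run (suc k) a (t ∷ ts) (s≤s le) =
        trans (primrec-shift (foldStep S) (pair a (codePolynomial (t ∷ ts))) k)
          (trans (cong (λ s → primrec s (λ _ → foldStep S) k) (step a (codeTerm t) (codePolynomial ts)))
            (run k (S a (codeTerm t)) ts le))

  foldℂ-correct : ∀ S (f : Polynomial (suc n) → Term (suc m) → Polynomial (suc n)) →
    (∀ p t → S (codePolynomial p) (codeTerm t) ≡ codePolynomial (f p t)) →
    ∀ p ts → foldℂ S (codePolynomial p) (codePolynomial ts) ≡ codePolynomial (foldl f p ts)
  foldℂ-correct S f S≡f p ts = trans (foldℂ-foldl S (codePolynomial p) ts) (fusion p ts)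
    where
    fusion : ∀ p ts → foldl (λ acc t → S acc (codeTerm t)) (codePolynomial p) ts ≡
      codePolynomial (foldl f p ts)
    fusion p []       = refl
    fusion p (t ∷ ts) rewrite S≡f p t = fusion (f p t) ts

-- Polynomial arithmetic, the equations `query`, and their computation on codes

module Polynomials where

  open import Data.Fin.Base using (toℕ)
  open import Data.Fin using (#_)
  open import Data.Integer.Base as ℤ using (ℤ; +_; -[1+_])
  open import Data.List.Base using ([]; _∷_; foldl)
  open import Data.Nat.Base hiding (parity)
  open import Data.Nat.Properties
  open import Data.Product.Base using (∃-syntax; _,_; proj₁; proj₂)
  open import Data.Vec.Base using (Vec; _∷_; tabulate; zipWith)
  open import Data.Vec.Properties using (tabulate-cong; tabulate∘lookup; lookup-zipWith)
  open import Function.Base using (_∘_)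
  open import Relation.Binary.PropositionalEquality
  open Computability
  open Coding

  private
    variable
      m n : ℕ
      F G K M : Vec ℕ n → ℕ

  abstract
    parityᶜ : Computable F → Computable (λ xs → parity (F xs))
    parityᶜ f = primrecᶜ (constᶜ 0) (constᶜ 1 ∸ᶜ varᶜ (# 1)) f

    magnitudeᶜ : Computable F → Computable (λ xs → magnitude (F xs))
    magnitudeᶜ f =
      primrecᶜ (constᶜ 0) (varᶜ (# 1) +ᶜ parityᶜ (varᶜ (# 0))) f +ᶜ parityᶜ f

    mulℤᶜ : Computable F → Computable G → Computable (λ xs → mulℤ (F xs) (G xs))
    mulℤᶜ f g =
      constᶜ 2 *ᶜ (magnitudeᶜ f *ᶜ magnitudeᶜ g) ∸ᶜ parityᶜ (parityᶜ f +ᶜ parityᶜ g)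

    componentᶜ : Computable M → Computable F → Computable K →
      Computable (λ xs → component (M xs) (F xs) (K xs))
    componentᶜ {F = F} {K = K} m v i = if0ᶜ (m ∸ᶜ i) tails (π₁ᶜ tails)
      where
      tails : Computable (λ xs → primrec (F xs) (λ _ → π₂) (K xs))
      tails = primrecᶜ v (π₂ᶜ (varᶜ (# 1))) i

    tabulateℂᶜ : ∀ {Φ : Vec ℕ (suc n) → ℕ} → Computable M → Computable Φ →
      Computable (λ xs → tabulateℂ (M xs) (λ i → Φ (i ∷ xs)))
    tabulateℂᶜ m φ = primrecᶜ (φ [ m ∷ˢ idˢ ]ᶜ)
      -- `primrecᶜ` puts the counter and the accumulator in front of `xs`; the two weakenings drop
      -- them again.
      (pairᶜ (φ [ (m ↑ ↑ ∸ᶜ sucᶜ (varᶜ (# 0))) ∷ˢ (weakenˢ ∘ˢ weakenˢ) ]ᶜ) (varᶜ (# 1))) m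

    foldℂᶜ : ∀ {S : Vec ℕ (2 + n) → ℕ} → Computable S → Computable F → Computable G →
      Computable (λ xs → foldℂ (λ a t → S (a ∷ t ∷ xs)) (F xs) (G xs))
    foldℂᶜ s a l =
      let state = varᶜ (# 1)
          popped = π₂ᶜ state ∸ᶜ constᶜ 1
      in π₁ᶜ (primrecᶜ (pairᶜ a l)
           (if0ᶜ (π₂ᶜ state) state
             (pairᶜ (s [ π₁ᶜ state ∷ˢ π₁ᶜ popped ∷ˢ (weakenˢ ∘ˢ weakenˢ) ]ᶜ) (π₂ᶜ popped))) l)

  opaque
    -- Concatenation up to order. Like `mulP` and `liftP`, it is written as a left fold so that
    -- `foldℂ` imitates it step by step on codes.
    addP : Polynomial n → Polynomial n → Polynomial n
    addP p q = foldl (λ acc t → t ∷ acc) q p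

  mulTerm : Term n → Term n → Term n
  mulTerm (c , es) (d , fs) = c ℤ.* d , zipWith _+_ es fs

  opaque
    mulP : Polynomial n → Polynomial n → Polynomial n
    mulP p q = foldl (λ acc t → foldl (λ acc′ s → mulTerm t s ∷ acc′) acc q) [] p

  liftTerm : Term n → Term (4 + n)
  liftTerm (c , es) = c , 0 ∷ 0 ∷ 0 ∷ 0 ∷ es

  opaque
    liftP : Polynomial n → Polynomial (4 + n)
    liftP = foldl (λ acc t → liftTerm t ∷ acc) []

  opaque
    constP : ℤ → Polynomial n
    constP c = (c , tabulate (λ _ → 0)) ∷ []

    -- the constant 1 if i ≥ n
    varP : ℕ → Polynomial n
    varP i = (+ 1 , tabulate (δ i ∘ toℕ)) ∷ []

  codeℤ-surjective : ∀ z → ∃[ c ] codeℤ c ≡ z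
  codeℤ-surjective zero = + 0 , refl
  codeℤ-surjective (suc z) with codeℤ-surjective z
  ... | + n      , refl = -[1+ n ] , refl
  ... | -[1+ n ] , refl = + suc n , cong suc (+-suc n (n + 0))

  decodeℤ : ℕ → ℤ
  decodeℤ = proj₁ ∘ codeℤ-surjective

  -- The index `j` codes a leading coefficient, positive by the `suc`, and a constant term. Hence
  -- there is exactly one rational zero, `root j`, and as `j` varies these zeros run through all of
  -- ℚ, with repetitions.
  linearP : ℕ → ℕ → Polynomial n
  linearP i j = addP (mulP (constP (+ suc (π₁ j))) (varP i)) (constP (decodeℤ (π₂ j)))

  linearsP : ℕ → ℕ → Polynomial n
  linearsP i = primrec (constP (+ 1)) (λ j r → mulP (linearP i j) r)

  sqP : Polynomial n → Polynomial n
  sqP p = mulP p p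

  formP : ℤ → Polynomial n
  formP M = mulP
    (addP (addP (sqP (constP M)) (sqP (varP 1))) (sqP (varP 2)))
    (addP (sqP (addP (addP (varP 3) (varP 3)) (constP M))) (mulP (constP (+ 7)) (sqP (constP M))))

  -- The system D = 0, x₀ ∏_{j<N} linearP (4 + i) j = formP M as a sum of two squares; i counts the
  -- variables of D, which come after the four new ones.
  query : ℤ → Equation → ℕ → ℕ → Equation
  query M (m , D) N i = 4 + m , addP (sqP (liftP D))
    (sqP (addP (mulP (varP 0) (linearsP (4 + i) N)) (mulP (constP -[1+ 0 ]) (formP M))))

  opaque
    addℂ : ℕ → ℕ → ℕ
    addℂ p q = foldℂ (λ acc t → suc ⟪ t , acc ⟫) q p

  mulTermℂ : ℕ → ℕ → ℕ → ℕ
  mulTermℂ m t s =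
    ⟪ mulℤ (π₁ t) (π₁ s) , tabulateℂ m (λ i → component m (π₂ t) i + component m (π₂ s) i) ⟫

  opaque
    mulℂ : ℕ → ℕ → ℕ → ℕ
    mulℂ m p q =
      foldℂ (λ acc t → foldℂ (λ acc′ s → suc ⟪ mulTermℂ m t s , acc′ ⟫) acc q) 0 p

  liftTermℂ : ℕ → ℕ
  liftTermℂ t = ⟪ π₁ t , ⟪ 0 , ⟪ 0 , ⟪ 0 , ⟪ 0 , π₂ t ⟫ ⟫ ⟫ ⟫ ⟫

  opaque
    liftℂ : ℕ → ℕ
    liftℂ p = foldℂ (λ acc t → suc ⟪ liftTermℂ t , acc ⟫) 0 p

  opaque
    constℂ : ℕ → ℕ → ℕ
    constℂ m c = suc ⟪ ⟪ c , tabulateℂ m (λ _ → 0) ⟫ , 0 ⟫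

    -- Coefficients enter as codes: 2 stands for 1 here, and below 14 stands for 7 and the 1 in
    -- `queryBodyℂ` for -1.
    varℂ : ℕ → ℕ → ℕ
    varℂ m i = suc ⟪ ⟪ 2 , tabulateℂ m (δ i) ⟫ , 0 ⟫

  opaque
    linearℂ : ℕ → ℕ → ℕ → ℕ
    linearℂ m i j = addℂ (mulℂ m (constℂ m (2 * suc (π₁ j))) (varℂ m i)) (constℂ m (π₂ j))

    linearsℂ : ℕ → ℕ → ℕ → ℕ
    linearsℂ m i = primrec (constℂ m 2) (λ j r → mulℂ m (linearℂ m i j) r)

    sqℂ : ℕ → ℕ → ℕ
    sqℂ m p = mulℂ m p p

    formℂ : ℕ → ℕ → ℕ
    formℂ m c = mulℂ m
      (addℂ (addℂ (sqℂ m (constℂ m c)) (sqℂ m (varℂ m 1))) (sqℂ m (varℂ m 2)))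
      (addℂ (sqℂ m (addℂ (addℂ (varℂ m 3) (varℂ m 3)) (constℂ m c)))
        (mulℂ m (constℂ m 14) (sqℂ m (constℂ m c))))

    queryBodyℂ : ℕ → ℕ → ℕ → ℕ → ℕ → ℕ
    queryBodyℂ m c D N i = addℂ (sqℂ m (liftℂ D))
      (sqℂ m (addℂ (mulℂ m (varℂ m 0) (linearsℂ m (4 + i) N)) (mulℂ m (constℂ m 1) (formℂ m c))))

    queryℂ : ℕ → ℕ → ℕ → ℕ → ℕ
    queryℂ c x N i = ⟪ 4 + π₁ x , queryBodyℂ (4 + π₁ x) c (π₂ x) N i ⟫

  cp : Polynomial (suc m) → ℕ
  cp = codePolynomial

  opaque
    unfolding ⟪_,_⟫ addP addℂ

    addℂ-correct : ∀ (p q : Polynomial (suc m)) → addℂ (cp p) (cp q) ≡ cp (addP p q)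
    addℂ-correct p q =
      foldℂ-correct (λ acc t → suc (pair t acc)) (λ acc t → t ∷ acc) (λ _ _ → refl) q p

  opaque
    unfolding ⟪_,_⟫

    mulTermℂ-correct : ∀ (t s : Term (suc m)) →
      mulTermℂ m (codeTerm t) (codeTerm s) ≡ codeTerm (mulTerm t s)
    mulTermℂ-correct {m} (c , es) (d , fs) = cong₂ pair
      (trans (cong₂ mulℤ (π₁-pair (codeℤ c) (codeVec es)) (π₁-pair (codeℤ d) (codeVec fs)))
        (mulℤ-correct c d))
      (trans (cong₂ (λ v w → tabulateℂ m (λ i → component m v i + component m w i))
          (π₂-pair (codeℤ c) (codeVec es)) (π₂-pair (codeℤ d) (codeVec fs)))
        (trans (tabulateℂ-correct m (λ i → component m (codeVec es) i + component m (codeVec fs) i)) (cong (codeVec {m}) (trans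
          (tabulate-cong (λ i → trans (cong₂ _+_ (component-correct es i) (component-correct fs i))
            (sym (lookup-zipWith _+_ i es fs))))
          (tabulate∘lookup (zipWith _+_ es fs))))))

  opaque
    unfolding ⟪_,_⟫ mulP mulℂ

    mulℂ-correct : ∀ (p q : Polynomial (suc m)) → mulℂ m (cp p) (cp q) ≡ cp (mulP p q)
    mulℂ-correct {m} p q = foldℂ-correct
      (λ acc t → foldℂ (λ acc′ s → suc (pair (mulTermℂ m t s) acc′)) acc (cp q))
      (λ acc t → foldl (λ acc′ s → mulTerm t s ∷ acc′) acc q)
      (λ acc t → foldℂ-correct
        (λ acc′ s → suc (pair (mulTermℂ m (codeTerm t) s) acc′)) (λ acc′ s → mulTerm t s ∷ acc′)
        (λ acc′ s → cong (λ u → suc (pair u (cp acc′))) (mulTermℂ-correct t s)) acc q) [] p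

  opaque
    unfolding ⟪_,_⟫ liftP liftℂ

    liftℂ-correct : ∀ (p : Polynomial (suc m)) → liftℂ (cp p) ≡ cp (liftP p)
    liftℂ-correct p = foldℂ-correct
      (λ acc t → suc (pair (liftTermℂ t) acc)) (λ acc t → liftTerm t ∷ acc) (λ where
      -- `codeVec` forms a pair only in front of a visibly non-empty tail, hence the pattern for
      -- `es`.
      acc (c , es@(_ ∷ _)) → cong (λ u → suc (pair u (cp acc)))
        (cong₂ (λ x y → pair x (pair 0 (pair 0 (pair 0 (pair 0 y)))))
          (π₁-pair (codeℤ c) (codeVec es)) (π₂-pair (codeℤ c) (codeVec es)))) [] p

  opaque
    unfolding ⟪_,_⟫ constP constℂ

    constℂ-correct : ∀ m c → constℂ m (codeℤ c) ≡ cp {m} (constP c)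
    constℂ-correct m c =
      cong (λ v → suc (pair (pair (codeℤ c) v) 0)) (tabulateℂ-correct m (λ _ → 0))

    varℂ-correct : ∀ m i → varℂ m i ≡ cp {m} (varP i)
    varℂ-correct m i = cong (λ v → suc (pair (pair 2 v) 0)) (tabulateℂ-correct m (δ i))

  addℂ-≡ : ∀ {a b} {p q : Polynomial (suc m)} → a ≡ cp p → b ≡ cp q → addℂ a b ≡ cp (addP p q)
  addℂ-≡ {p = p} {q} refl refl = addℂ-correct p q

  mulℂ-≡ : ∀ {a b} {p q : Polynomial (suc m)} → a ≡ cp p → b ≡ cp q → mulℂ m a b ≡ cp (mulP p q)
  mulℂ-≡ {p = p} {q} refl refl = mulℂ-correct p q

  opaque
    unfolding sqℂ

    sqℂ-≡ : ∀ {a} {p : Polynomial (suc m)} → a ≡ cp p → sqℂ m a ≡ cp (sqP p)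
    sqℂ-≡ eq = mulℂ-≡ eq eq

  opaque
    unfolding linearsℂ

    linearsℂ-correct : ∀ m i N → linearsℂ m i N ≡ cp {m} (linearsP i N)
    linearsℂ-correct m i zero    = constℂ-correct m (+ 1)
    linearsℂ-correct m i (suc j) = mulℂ-≡ (addℂ-≡
        (mulℂ-≡ (constℂ-correct m (+ suc (π₁ j))) (varℂ-correct m i))
        (trans (cong (constℂ m) (sym (proj₂ (codeℤ-surjective (π₂ j)))))
          (constℂ-correct m (decodeℤ (π₂ j)))))
      (linearsℂ-correct m i j)

  opaque
    unfolding formℂ

    formℂ-correct : ∀ m M → formℂ m (codeℤ M) ≡ cp {m} (formP M)
    formℂ-correct m M = mulℂ-≡
      (addℂ-≡ (addℂ-≡ (sqℂ-≡ M′) (sqℂ-≡ (varℂ-correct m 1))) (sqℂ-≡ (varℂ-correct m 2)))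
      (addℂ-≡ (sqℂ-≡ (addℂ-≡ (addℂ-≡ (varℂ-correct m 3) (varℂ-correct m 3)) M′))
        (mulℂ-≡ (constℂ-correct m (+ 7)) (sqℂ-≡ M′)))
      where
      M′ : constℂ m (codeℤ M) ≡ cp {m} (constP M)
      M′ = constℂ-correct m M

  opaque
    unfolding ⟪_,_⟫ queryℂ

    queryℂ-correct : ∀ M E N i → queryℂ (codeℤ M) (code E) N i ≡ code (query M E N i)
    queryℂ-correct M (m , D) N i = trans
      (cong₂ (λ m D → pair (4 + m) (queryBodyℂ (4 + m) (codeℤ M) D N i))
        (π₁-pair m (cp D)) (π₂-pair m (cp D)))
      (cong (pair (4 + m)) (addℂ-≡ (sqℂ-≡ (liftℂ-correct D))
        (sqℂ-≡ (addℂ-≡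
          (mulℂ-≡ (varℂ-correct (4 + m) 0) (linearsℂ-correct (4 + m) (4 + i) N))
          (mulℂ-≡ (constℂ-correct (4 + m) -[1+ 0 ]) (formℂ-correct (4 + m) M))))))

  opaque
    unfolding addℂ

    addℂᶜ : Computable F → Computable G → Computable (λ xs → addℂ (F xs) (G xs))
    addℂᶜ p q = foldℂᶜ (sucᶜ (pairᶜ (varᶜ (# 1)) (varᶜ (# 0)))) q p

  abstract
    mulTermℂᶜ : Computable M → Computable F → Computable G →
      Computable (λ xs → mulTermℂ (M xs) (F xs) (G xs))
    mulTermℂᶜ m t s = pairᶜ (mulℤᶜ (π₁ᶜ t) (π₁ᶜ s)) (tabulateℂᶜ m
      (componentᶜ (m ↑) (π₂ᶜ t ↑) (varᶜ (# 0)) +ᶜ componentᶜ (m ↑) (π₂ᶜ s ↑) (varᶜ (# 0))))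

  opaque
    unfolding mulℂ

    mulℂᶜ : Computable M → Computable F → Computable G →
      Computable (λ xs → mulℂ (M xs) (F xs) (G xs))
    mulℂᶜ m p q = foldℂᶜ
      (foldℂᶜ (sucᶜ (pairᶜ (mulTermℂᶜ (m ↑ ↑ ↑ ↑) (varᶜ (# 3)) (varᶜ (# 1))) (varᶜ (# 0))))
        (varᶜ (# 0)) (q ↑ ↑))
      (constᶜ 0) p

  opaque
    unfolding liftℂ

    liftℂᶜ : Computable F → Computable (λ xs → liftℂ (F xs))
    liftℂᶜ p = foldℂᶜ
      (sucᶜ (pairᶜ
        (pairᶜ (π₁ᶜ (varᶜ (# 1))) (0, (0, (0, (0, π₂ᶜ (varᶜ (# 1)))))))
        (varᶜ (# 0))))
      (constᶜ 0) p
      where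
      0,_ : Computable F → Computable (λ xs → ⟪ 0 , F xs ⟫)
      0, f = pairᶜ (constᶜ 0) f

  opaque
    unfolding constℂ

    constℂᶜ : Computable M → Computable F → Computable (λ xs → constℂ (M xs) (F xs))
    constℂᶜ m c = sucᶜ (pairᶜ (pairᶜ c (tabulateℂᶜ m (constᶜ 0))) (constᶜ 0))

    varℂᶜ : Computable M → Computable F → Computable (λ xs → varℂ (M xs) (F xs))
    varℂᶜ m i =
      sucᶜ (pairᶜ (pairᶜ (constᶜ 2) (tabulateℂᶜ m (δᶜ (i ↑) (varᶜ (# 0))))) (constᶜ 0))

  opaque
    unfolding linearℂ

    linearℂᶜ : Computable M → Computable F → Computable G →
      Computable (λ xs → linearℂ (M xs) (F xs) (G xs))
    linearℂᶜ m i j = addℂᶜ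
      (mulℂᶜ m (constℂᶜ m (constᶜ 2 *ᶜ sucᶜ (π₁ᶜ j))) (varℂᶜ m i)) (constℂᶜ m (π₂ᶜ j))

    linearsℂᶜ : Computable M → Computable F → Computable G →
      Computable (λ xs → linearsℂ (M xs) (F xs) (G xs))
    linearsℂᶜ m i N = primrecᶜ (constℂᶜ m (constᶜ 2))
      (mulℂᶜ (m ↑ ↑) (linearℂᶜ (m ↑ ↑) (i ↑ ↑) (varᶜ (# 0))) (varᶜ (# 1))) N

    sqℂᶜ : Computable M → Computable F → Computable (λ xs → sqℂ (M xs) (F xs))
    sqℂᶜ m p = mulℂᶜ m p p

    formℂᶜ : Computable M → ∀ c → Computable (λ xs → formℂ (M xs) c)
    formℂᶜ m c =
      let c′ = constℂᶜ m (constᶜ c)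
          x = λ i → varℂᶜ m (constᶜ i)
      in mulℂᶜ m
           (addℂᶜ (addℂᶜ (sqℂᶜ m c′) (sqℂᶜ m (x 1))) (sqℂᶜ m (x 2)))
           (addℂᶜ (sqℂᶜ m (addℂᶜ (addℂᶜ (x 3) (x 3)) c′))
             (mulℂᶜ m (constℂᶜ m (constᶜ 14)) (sqℂᶜ m c′)))

    queryBodyℂᶜ : Computable M → ∀ c → Computable F → Computable G → Computable K →
      Computable (λ xs → queryBodyℂ (M xs) c (F xs) (G xs) (K xs))
    queryBodyℂᶜ m c D N i = addℂᶜ (sqℂᶜ m (liftℂᶜ D))
      (sqℂᶜ m (addℂᶜ
        (mulℂᶜ m (varℂᶜ m (constᶜ 0)) (linearsℂᶜ m (constᶜ 4 +ᶜ i) N))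
        (mulℂᶜ m (constℂᶜ m (constᶜ 1)) (formℂᶜ m c))))

    queryℂᶜ : ∀ c → Computable F → Computable G → Computable K →
      Computable (λ xs → queryℂ c (F xs) (G xs) (K xs))
    queryℂᶜ c x N i = pairᶜ (constᶜ 4 +ᶜ π₁ᶜ x)
      (queryBodyℂᶜ (constᶜ 4 +ᶜ π₁ᶜ x) c (π₂ᶜ x) N i)

-- The coding of equations is a bijection

module CodeBijection where

  open import Data.Integer.Base using (+_; -[1+_])
  open import Data.List.Base using ([]; _∷_)
  open import Data.Nat.Base hiding (parity)
  open import Data.Nat.Properties
  open import Data.Product.Base using (∃-syntax; _×_; _,_)
  open import Data.Vec.Base using (Vec; []; _∷_)
  open import Relation.Binary.PropositionalEquality
  open import Relation.Nullary using (contradiction)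
  open Computability
  open Coding
  open Polynomials using (codeℤ-surjective)

  private
    variable
      m : ℕ

  pair-injective : ∀ x y u v → pair x y ≡ pair u v → x ≡ u × y ≡ v
  pair-injective x y u v eq =
    trans (sym (π₁-pair x y)) (trans (cong π₁ eq) (π₁-pair u v)) ,
    trans (sym (π₂-pair x y)) (trans (cong π₂ eq) (π₂-pair u v))

  codeℤ-injective : ∀ c d → codeℤ c ≡ codeℤ d → c ≡ d
  codeℤ-injective (+ m) (+ n) eq =
    cong +_ (trans (sym (magnitude-+ m)) (trans (cong magnitude eq) (magnitude-+ n)))
  codeℤ-injective (+ m) -[1+ n ] eq =
    contradiction (trans (sym (parity-+ m)) (trans (cong parity eq) (parity-- n))) 0≢1+n
  codeℤ-injective -[1+ m ] (+ n) eq =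
    contradiction (trans (sym (parity-+ n)) (trans (cong parity (sym eq)) (parity-- m))) 0≢1+n
  codeℤ-injective -[1+ m ] -[1+ n ] eq = cong -[1+_] (suc-injective
    (trans (sym (magnitude-- m)) (trans (cong magnitude eq) (magnitude-- n))))

  codeVec-injective : ∀ (es fs : Vec ℕ (suc m)) → codeVec es ≡ codeVec fs → es ≡ fs
  codeVec-injective (e ∷ [])      (f ∷ [])      eq = cong (_∷ []) eq
  codeVec-injective (e ∷ e′ ∷ es) (f ∷ f′ ∷ fs) eq with pair-injective e (codeVec (e′ ∷ es)) f (codeVec (f′ ∷ fs)) eq
  ... | e≡f , eq′ = cong₂ _∷_ e≡f (codeVec-injective (e′ ∷ es) (f′ ∷ fs) eq′)

  codeTerm-injective : ∀ (t s : Term (suc m)) → codeTerm t ≡ codeTerm s → t ≡ s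
  codeTerm-injective (c , es) (d , fs) eq
    with pair-injective (codeℤ c) (codeVec es) (codeℤ d) (codeVec fs) eq
  ... | c≡d , es≡fs = cong₂ _,_ (codeℤ-injective c d c≡d) (codeVec-injective es fs es≡fs)

  codePolynomial-injective : ∀ (p q : Polynomial (suc m)) →
    codePolynomial p ≡ codePolynomial q → p ≡ q
  codePolynomial-injective []      []      _  = refl
  codePolynomial-injective (t ∷ p) (s ∷ q) eq
    with pair-injective (codeTerm t) (codePolynomial p) (codeTerm s) (codePolynomial q) (suc-injective eq)
  ... | t≡s , p≡q = cong₂ _∷_ (codeTerm-injective t s t≡s) (codePolynomial-injective p q p≡q)

  -- `codes S` speaks of some equation with a given code; injectivity identifies it with the
  -- equation at hand.
  code-injective : ∀ E E′ → code E ≡ code E′ → E ≡ E′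
  code-injective (m , D) (m′ , D′) eq
    with pair-injective m (codePolynomial D) m′ (codePolynomial D′) eq
  ... | refl , D≡D′ = cong (m ,_) (codePolynomial-injective D D′ D≡D′)

  codeVec-surjective : ∀ m z → ∃[ es ] codeVec {m} es ≡ z
  codeVec-surjective zero    z = z ∷ [] , refl
  codeVec-surjective (suc m) z with pair-surjective z
  ... | x , y , refl with codeVec-surjective m y
  ...   | es@(_ ∷ _) , refl = x ∷ es , refl

  codeTerm-surjective : ∀ m z → ∃[ t ] codeTerm {m} t ≡ z
  codeTerm-surjective m z with pair-surjective z
  ... | x , y , refl with codeℤ-surjective x | codeVec-surjective m y
  ...   | c , refl | es , refl = (c , es) , refl

  codePolynomial-surjective : ∀ m z → ∃[ p ] codePolynomial {m} p ≡ z
  codePolynomial-surjective m z = go z z ≤-refl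
    where
    -- `k` is a bound for strong induction: the tail has code `y`, and y ≤ pair x y < z.
    go : ∀ k z → z ≤ k → ∃[ p ] codePolynomial {m} p ≡ z
    go _       zero    _         = [] , refl
    go (suc k) (suc z) (s≤s z≤k) with pair-surjective z
    ... | x , y , refl with codeTerm-surjective m x | go k y (≤-trans (m≤n+m y _) z≤k)
    ...   | t , refl | p , refl = t ∷ p , refl

  -- Every input on which the search halts can thus be read as an equation.
  code-surjective : ∀ z → ∃[ E ] code E ≡ z
  code-surjective z with pair-surjective z
  ... | m , y , refl with codePolynomial-surjective m y
  ...   | D , refl = (m , D) , refl

-- Integers inside ℚ, and positivity of squares

module Rationals where

  open import Data.Integer.Base as ℤ using (ℤ; +_)
  import Data.Integer.Properties as ℤ
  open import Data.Nat.Base using (suc)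
  import Data.Nat.Properties as ℕ
  open import Data.Rational.Base
  open import Data.Rational.Properties
  import Data.Rational.Unnormalised.Base as ℚᵘ
  import Data.Rational.Unnormalised.Properties as ℚᵘ
  open import Data.Sum.Base using (_⊎_; inj₁; inj₂)
  open import Relation.Binary.PropositionalEquality
  open import Relation.Nullary using (yes; no; contradiction)

  ι : ℤ → ℚ
  ι c = c / 1

  private
    toℚᵘ-ι : ∀ c → toℚᵘ (ι c) ℚᵘ.≃ ℚᵘ.mkℚᵘ c 0
    toℚᵘ-ι c = toℚᵘ-fromℚᵘ (ℚᵘ.mkℚᵘ c 0)

  abstract
    -- As for the next lemmas, the check takes place among unnormalised fractions, where no common
    -- factor has to be cancelled.
    ι-+ : ∀ c d → ι (c ℤ.+ d) ≡ ι c + ι d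
    ι-+ c d = toℚᵘ-injective (ℚᵘ.≃-trans (toℚᵘ-ι (c ℤ.+ d)) (ℚᵘ.≃-sym
      (ℚᵘ.≃-trans (toℚᵘ-homo-+ (ι c) (ι d)) (ℚᵘ.≃-trans (ℚᵘ.+-cong (toℚᵘ-ι c) (toℚᵘ-ι d))
        (ℚᵘ.*≡* (cong₂ (λ x y → (x ℤ.+ y) ℤ.* + 1) (ℤ.*-identityʳ c) (ℤ.*-identityʳ d)))))))

    ι-* : ∀ c d → ι (c ℤ.* d) ≡ ι c * ι d
    ι-* c d = toℚᵘ-injective (ℚᵘ.≃-trans (toℚᵘ-ι (c ℤ.* d)) (ℚᵘ.≃-sym
      (ℚᵘ.≃-trans (toℚᵘ-homo-* (ι c) (ι d)) (ℚᵘ.≃-trans (ℚᵘ.*-cong (toℚᵘ-ι c) (toℚᵘ-ι d))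
        (ℚᵘ.*≡* refl)))))

    ι-neg : ∀ c → ι (ℤ.- c) ≡ - ι c
    ι-neg c = toℚᵘ-injective (ℚᵘ.≃-trans (toℚᵘ-ι (ℤ.- c)) (ℚᵘ.≃-sym
      (ℚᵘ.≃-trans (toℚᵘ-homo‿- (ι c)) (ℚᵘ.-‿cong (toℚᵘ-ι c)))))

    ι≡0⇒≡0 : ∀ c → ι c ≡ 0ℚ → c ≡ + 0
    ι≡0⇒≡0 c ι≡0 with ℚᵘ.≃-trans (ℚᵘ.≃-sym (toℚᵘ-ι c)) (ℚᵘ.≃-reflexive (cong toℚᵘ ι≡0))
    ... | ℚᵘ.*≡* eq = trans (sym (ℤ.*-identityʳ c)) eq

    numerator : ∀ n d → ι (+ suc d) * (n / suc d) ≡ ι n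
    numerator n d = toℚᵘ-injective (ℚᵘ.≃-trans (toℚᵘ-homo-* (ι (+ suc d)) (n / suc d))
      (ℚᵘ.≃-trans (ℚᵘ.*-cong (toℚᵘ-ι (+ suc d)) (toℚᵘ-fromℚᵘ (ℚᵘ.mkℚᵘ n d)))
        (ℚᵘ.≃-trans (ℚᵘ.*≡* (trans (ℤ.*-identityʳ (+ suc d ℤ.* n))
            (trans (ℤ.*-comm (+ suc d) n)
              (cong (λ e → n ℤ.* + suc e) (sym (ℕ.+-identityʳ d))))))
          (ℚᵘ.≃-sym (toℚᵘ-ι n)))))

    ↧*≡↥ : ∀ p → ι (↧ p) * p ≡ ι (↥ p)
    ↧*≡↥ p@(mkℚ n d _) = trans (cong (ι (+ suc d) *_) (sym (↥p/↧p≡p p))) (numerator n d)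

    *≡0⇒≡0 : ∀ p q → p * q ≡ 0ℚ → p ≡ 0ℚ ⊎ q ≡ 0ℚ
    *≡0⇒≡0 p q pq≡0 with p ≟ 0ℚ
    ... | yes p≡0 = inj₁ p≡0
    ... | no  p≢0 = inj₂ (begin
      q               ≡⟨ *-identityˡ q ⟨
      1ℚ * q          ≡⟨ cong (_* q) (*-inverseˡ p) ⟨
      1/ p * p * q    ≡⟨ *-assoc (1/ p) p q ⟩
      1/ p * (p * q)  ≡⟨ cong (1/ p *_) pq≡0 ⟩
      1/ p * 0ℚ       ≡⟨ *-zeroʳ (1/ p) ⟩
      0ℚ              ∎)
      where
      open ≡-Reasoning
      instance
        p-nonZero : NonZero p
        p-nonZero = ≢-nonZero p≢0

    p²-nonNegative : ∀ p → NonNegative (p * p)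
    p²-nonNegative p with ≤-total 0ℚ p
    ... | inj₁ 0≤p = nonNeg*nonNeg⇒nonNeg p {{nonNegative 0≤p}} p {{nonNegative 0≤p}}
    ... | inj₂ p≤0 = nonPos*nonPos⇒nonPos p {{nonPositive p≤0}} p {{nonPositive p≤0}}

    p²-positive : ∀ p → p ≢ 0ℚ → Positive (p * p)
    p²-positive p p≢0 = nonNeg∧nonZero⇒pos (p * p) {{p²-nonNegative p}} {{≢-nonZero p²≢0}}
      where
      p²≢0 : p * p ≢ 0ℚ
      p²≢0 p²≡0 with *≡0⇒≡0 p p p²≡0
      ... | inj₁ p≡0 = p≢0 p≡0
      ... | inj₂ p≡0 = p≢0 p≡0

    positive⇒≢0 : ∀ {p} → Positive p → p ≢ 0ℚ
    positive⇒≢0 () refl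

    -- This allows `query` to merge two equations into one.
    p²+q²≡0⇒p≡0 : ∀ p q → p * p + q * q ≡ 0ℚ → p ≡ 0ℚ
    p²+q²≡0⇒p≡0 p q eq with p ≟ 0ℚ
    ... | yes p≡0 = p≡0
    ... | no  p≢0 = contradiction eq (positive⇒≢0
      (pos+nonNeg⇒pos (p * p) {{p²-positive p p≢0}} (q * q) {{p²-nonNegative q}}))

    p²+q²≡0⇒q≡0 : ∀ p q → p * p + q * q ≡ 0ℚ → q ≡ 0ℚ
    p²+q²≡0⇒q≡0 p q eq = p²+q²≡0⇒p≡0 q p (trans (+-comm (q * q) (p * p)) eq)

-- Values of the constructed polynomials

module Evaluation where

  open import Data.Fin.Base using (Fin; zero; suc; toℕ)
  open import Data.Integer.Base using (+_; -[1+_])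
  open import Data.List.Base using (List; []; _∷_; foldl; foldr; map)
  open import Data.Nat.Base as ℕ using (ℕ; zero; suc; z<s)
  open import Data.Product.Base using (_,_; proj₂)
  open import Data.Rational.Base
  open import Data.Rational.Properties
  open import Data.Rational.Solver using (module +-*-Solver)
  open import Data.Vec.Base as Vec using (Vec; []; _∷_; lookup; tabulate; zipWith)
  open import Function.Base using (_∘_)
  open import Relation.Binary.PropositionalEquality
  open import Algebra.Definitions.RawSemiring +-*-rawSemiring using (_^_)
  open Computability using (δ; δ-<; δ->; primrec; π₁; π₂)
  open Polynomials
  open Rationals

  open +-*-Solver using (solve; _:=_; _:+_; _:*_; con)

  private
    variable
      m n : ℕ

  monomial : Vec ℚ n → Vec ℕ n → ℚ
  monomial xs es = Vec.foldr (λ _ → ℚ) _*_ 1ℚ (zipWith _^_ xs es)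

  interchange : ∀ a b c d → (a * b) * (c * d) ≡ (a * c) * (b * d)
  interchange = solve 4 (λ a b c d → (a :* b) :* (c :* d) := (a :* c) :* (b :* d)) refl

  ^-+ : ∀ x a b → x ^ (a ℕ.+ b) ≡ x ^ a * x ^ b
  ^-+ x zero    b = sym (*-identityˡ (x ^ b))
  ^-+ x (suc a) b = trans (cong (x *_) (^-+ x a b)) (sym (*-assoc x (x ^ a) (x ^ b)))

  monomial-+ : ∀ (xs : Vec ℚ n) es fs →
    monomial xs (zipWith ℕ._+_ es fs) ≡ monomial xs es * monomial xs fs
  monomial-+ []       []       []       = refl
  monomial-+ (x ∷ xs) (e ∷ es) (f ∷ fs) = trans
    (cong₂ _*_ (^-+ x e f) (monomial-+ xs es fs))
    (interchange (x ^ e) (x ^ f) (monomial xs es) (monomial xs fs))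

  monomial-0 : ∀ (xs : Vec ℚ n) (f : Fin n → ℕ) → (∀ i → f i ≡ 0) → monomial xs (tabulate f) ≡ 1ℚ
  monomial-0 []       f f≡0 = refl
  monomial-0 (x ∷ xs) f f≡0 rewrite f≡0 zero =
    trans (*-identityˡ _) (monomial-0 xs (f ∘ suc) (f≡0 ∘ suc))

  monomial-δ : ∀ (xs : Vec ℚ n) i → monomial xs (tabulate (δ (toℕ i) ∘ toℕ)) ≡ lookup xs i
  monomial-δ (x ∷ xs) zero = trans
    (cong ((x * 1ℚ) *_) (monomial-0 xs (δ 0 ∘ suc ∘ toℕ) (λ j → δ-< {0} {suc (toℕ j)} z<s)))
    (trans (*-identityʳ (x * 1ℚ)) (*-identityʳ x))
  monomial-δ (x ∷ xs) (suc i) = trans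
    (cong (λ e → x ^ e * monomial xs (tabulate (δ (toℕ i) ∘ toℕ))) (δ-> {suc (toℕ i)} {0} z<s))
    (trans (*-identityˡ _) (monomial-δ xs i))

  evalTerm-mul : ∀ (xs : Vec ℚ n) t s → evalTerm xs (mulTerm t s) ≡ evalTerm xs t * evalTerm xs s
  evalTerm-mul xs (c , es) (d , fs) = trans
    (cong₂ _*_ (ι-* c d) (monomial-+ xs es fs))
    (interchange (ι c) (ι d) (monomial xs es) (monomial xs fs))

  sum : List ℚ → ℚ
  sum = foldr _+_ 0ℚ

  sum-*ˡ : ∀ {A : Set} (f : A → ℚ) a ts → sum (map (λ t → a * f t) ts) ≡ a * sum (map f ts)
  sum-*ˡ f a []       = sym (*-zeroʳ a)
  sum-*ˡ f a (t ∷ ts) = trans (cong (λ z → a * f t + z) (sum-*ˡ f a ts))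
    (sym (*-distribˡ-+ a (f t) (sum (map f ts))))

  sum-*ʳ : ∀ {A : Set} (f : A → ℚ) a ts → sum (map (λ t → f t * a) ts) ≡ sum (map f ts) * a
  sum-*ʳ f a []       = sym (*-zeroˡ a)
  sum-*ʳ f a (t ∷ ts) = trans (cong (λ z → f t * a + z) (sum-*ʳ f a ts))
    (sym (*-distribʳ-+ a (f t) (sum (map f ts))))

  -- One induction serves addition, multiplication and lifting: each is a left fold whose step
  -- raises the value of the accumulated polynomial by an amount `v t` depending on `t` alone.
  eval-foldl : ∀ (xs : Vec ℚ n) (f : Polynomial n → Term m → Polynomial n) (v : Term m → ℚ) →
    (∀ p t → eval (f p t) xs ≡ v t + eval p xs) →
    ∀ ts p → eval (foldl f p ts) xs ≡ sum (map v ts) + eval p xs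
  eval-foldl xs f v step []       p = sym (+-identityˡ (eval p xs))
  eval-foldl xs f v step (t ∷ ts) p = trans (eval-foldl xs f v step ts (f p t))
    (trans (cong (λ z → sum (map v ts) + z) (step p t))
      (rearrange (sum (map v ts)) (v t) (eval p xs)))
    where
    rearrange : ∀ a b c → a + (b + c) ≡ (b + a) + c
    rearrange = solve 3 (λ a b c → a :+ (b :+ c) := (b :+ a) :+ c) refl

  opaque
    unfolding addP

    eval-add : ∀ (xs : Vec ℚ n) p q → eval (addP p q) xs ≡ eval p xs + eval q xs
    eval-add xs p q = eval-foldl xs (λ acc t → t ∷ acc) (evalTerm xs) (λ _ _ → refl) p q

  opaque
    unfolding mulP

    eval-mul : ∀ (xs : Vec ℚ n) p q → eval (mulP p q) xs ≡ eval p xs * eval q xs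
    eval-mul {n} xs p q = trans
      (eval-foldl xs row (λ t → evalTerm xs t * eval q xs) eval-row p [])
      (trans (+-identityʳ _) (sum-*ʳ (evalTerm xs) (eval q xs) p))
      where
      row : Polynomial n → Term n → Polynomial n
      row acc t = foldl (λ acc′ s → mulTerm t s ∷ acc′) acc q
      eval-row : ∀ acc t → eval (row acc t) xs ≡ evalTerm xs t * eval q xs + eval acc xs
      eval-row acc t = trans
        (eval-foldl xs (λ acc′ s → mulTerm t s ∷ acc′) (λ s → evalTerm xs t * evalTerm xs s)
          (λ acc′ s → cong (_+ eval acc′ xs) (evalTerm-mul xs t s)) q acc)
        (cong (_+ eval acc xs) (sum-*ˡ (evalTerm xs) (evalTerm xs t) q))

  opaque
    unfolding liftP

    eval-lift : ∀ a b c d (xs : Vec ℚ n) p → eval (liftP p) (a ∷ b ∷ c ∷ d ∷ xs) ≡ eval p xs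
    eval-lift a b c d xs p = trans
      (eval-foldl (a ∷ b ∷ c ∷ d ∷ xs) (λ acc t → liftTerm t ∷ acc) (evalTerm xs)
        (λ acc t → cong (_+ eval acc (a ∷ b ∷ c ∷ d ∷ xs)) (evalTerm-lift t)) p [])
      (+-identityʳ (eval p xs))
      where
      drop-ones : ∀ z → 1ℚ * (1ℚ * (1ℚ * (1ℚ * z))) ≡ z
      drop-ones = solve 1 (λ z → con 1ℚ :* (con 1ℚ :* (con 1ℚ :* (con 1ℚ :* z))) := z) refl
      evalTerm-lift : ∀ t → evalTerm (a ∷ b ∷ c ∷ d ∷ xs) (liftTerm t) ≡ evalTerm xs t
      evalTerm-lift (k , es) = cong (ι k *_) (drop-ones (monomial xs es))

  opaque
    unfolding constP

    eval-const : ∀ (xs : Vec ℚ n) c → eval (constP c) xs ≡ ι c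
    eval-const xs c = trans (+-identityʳ _)
      (trans (cong (ι c *_) (monomial-0 xs (λ _ → 0) (λ _ → refl))) (*-identityʳ (ι c)))

    eval-var : ∀ (xs : Vec ℚ n) i → eval (varP (toℕ i)) xs ≡ lookup xs i
    eval-var xs i = trans (+-identityʳ _) (trans (*-identityˡ _) (monomial-δ xs i))

  eval-sq : ∀ (xs : Vec ℚ n) p → eval (sqP p) xs ≡ eval p xs * eval p xs
  eval-sq xs p = eval-mul xs p p

  linear : ℕ → ℚ → ℚ
  linear j x = ι (+ suc (π₁ j)) * x + ι (decodeℤ (π₂ j))

  linears : ℕ → ℚ → ℚ
  linears N x = primrec 1ℚ (λ j r → linear j x * r) N

  form : ℚ → ℚ → ℚ → ℚ → ℚ
  form M u v w = (M * M + u * u + v * v) * ((w + w + M) * (w + w + M) + ι (+ 7) * (M * M))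

  eval-add-≡ : ∀ (xs : Vec ℚ n) {p q a b} → eval p xs ≡ a → eval q xs ≡ b → eval (addP p q) xs ≡ a + b
  eval-add-≡ xs {p} {q} refl refl = eval-add xs p q

  eval-mul-≡ : ∀ (xs : Vec ℚ n) {p q a b} → eval p xs ≡ a → eval q xs ≡ b → eval (mulP p q) xs ≡ a * b
  eval-mul-≡ xs {p} {q} refl refl = eval-mul xs p q

  eval-sq-≡ : ∀ (xs : Vec ℚ n) {p a} → eval p xs ≡ a → eval (sqP p) xs ≡ a * a
  eval-sq-≡ xs {p} refl = eval-sq xs p

  eval-linears : ∀ (xs : Vec ℚ n) i N → eval (linearsP (toℕ i) N) xs ≡ linears N (lookup xs i)
  eval-linears xs i zero    = eval-const xs (+ 1)
  eval-linears xs i (suc j) = eval-mul-≡ xs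
    (eval-add-≡ xs (eval-mul-≡ xs (eval-const xs (+ suc (π₁ j))) (eval-var xs i))
      (eval-const xs (decodeℤ (π₂ j))))
    (eval-linears xs i j)

  eval-form : ∀ (y u v w : ℚ) (xs : Vec ℚ n) M →
    eval (formP M) (y ∷ u ∷ v ∷ w ∷ xs) ≡ form (ι M) u v w
  eval-form y u v w xs M = eval-mul-≡ ys
    (eval-add-≡ ys (eval-add-≡ ys (eval-sq-≡ ys (eval-const ys M)) (eval-sq-≡ ys (eval-var ys (suc zero))))
      (eval-sq-≡ ys (eval-var ys (suc (suc zero)))))
    (eval-add-≡ ys
      (eval-sq-≡ ys (eval-add-≡ ys
        (eval-add-≡ ys (eval-var ys (suc (suc (suc zero)))) (eval-var ys (suc (suc (suc zero)))))
        (eval-const ys M)))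
      (eval-mul-≡ ys (eval-const ys (+ 7)) (eval-sq-≡ ys (eval-const ys M))))
    where
    ys = y ∷ u ∷ v ∷ w ∷ xs

  eval-query : ∀ y u v w (xs : Vec ℚ (suc m)) M D N i →
    let gap = y * linears N (lookup xs i) + ι -[1+ 0 ] * form (ι M) u v w
    in eval (proj₂ (query M (m , D) N (toℕ i))) (y ∷ u ∷ v ∷ w ∷ xs) ≡
      eval D xs * eval D xs + gap * gap
  eval-query y u v w xs M D N i = eval-add-≡ ys
    (eval-sq-≡ ys (eval-lift y u v w xs D))
    (eval-sq-≡ ys (eval-add-≡ ys
      (eval-mul-≡ ys (eval-var ys zero) (eval-linears ys (suc (suc (suc (suc i)))) N))
      (eval-mul-≡ ys (eval-const ys -[1+ 0 ]) (eval-form y u v w xs M))))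
    where
    ys = y ∷ u ∷ v ∷ w ∷ xs

-- Enumeration of ℚ, the definite form, and the search

module Finiteness where

  open import Data.Fin.Base using (Fin; zero; suc; toℕ; fromℕ<)
  open import Data.Fin.Properties using (toℕ<n; toℕ-fromℕ<)
  open import Data.Fin using (#_)
  import Data.Integer.Base as ℤ
  import Data.Integer.Properties as ℤ
  open import Data.Integer.Base using (ℤ; +_; -[1+_])
  open import Data.List.Base using (List; []; _∷_; map; upTo; filter; cartesianProductWith)
  open import Data.List.Membership.Propositional using (_∈_)
  open import Data.List.Membership.Propositional.Properties
    using (∈-map⁺; ∈-upTo⁺; ∈-filter⁺; ∈-filter⁻; ∈-cartesianProductWith⁺)
  open import Data.List.Relation.Unary.Any using (here; there)
  open import Data.Nat.Base as ℕ using (ℕ; zero; suc; s≤s)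
  import Data.Nat.Properties as ℕ
  open import Data.Product.Base using (∃; ∃-syntax; _×_; _,_; proj₁; proj₂)
  open import Data.Rational.Base
  open import Data.Rational.Properties
  open import Data.Rational.Solver using (module +-*-Solver)
  open import Data.Sum.Base using (inj₁; inj₂; [_,_]′)
  open import Data.Vec.Base as Vec using (Vec; []; _∷_; lookup)
  open import Data.Vec.Relation.Unary.All as All using (All; []; _∷_)
  open import Function.Base using (_∘_)
  open import Function.Bundles using (mk⇔; module Equivalence)
  open import Level using (Level)
  open import Relation.Binary.PropositionalEquality
  open import Relation.Nullary using (¬_; Dec; yes; no; contradiction)
  open import Relation.Nullary.Decidable using (map′; _×-dec_)
  open import Relation.Unary using (Pred)
  open Computability
  open Polynomials
  open CodeBijection
  open Rationals
  open Evaluation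
  open NumberTheory using (multiple-of-form-ℤ)

  open +-*-Solver using (solve; _:=_; _:+_; _:*_; :-_; con)

  private
    variable
      n : ℕ

  *-cancelˡ-≢0 : ∀ {a} p q → a ≢ 0ℚ → a * p ≡ a * q → p ≡ q
  *-cancelˡ-≢0 {a} p q a≢0 eq =
    [ (λ a≡0 → contradiction a≡0 a≢0)
    , (λ p-q≡0 → trans (restore p q) (trans (cong (_+ q) p-q≡0) (+-identityˡ q)))
    ]′ (*≡0⇒≡0 a (p + - q) (trans (distribute a p q)
         (trans (cong (_+ - (a * q)) eq) (+-inverseʳ (a * q)))))
    where
    distribute : ∀ a p q → a * (p + - q) ≡ a * p + - (a * q)
    distribute = solve 3 (λ a p q → a :* (p :+ :- q) := a :* p :+ :- (a :* q)) refl
    restore : ∀ p q → p ≡ (p + - q) + q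
    restore = solve 2 (λ p q → p := (p :+ :- q) :+ q) refl

  ι-suc≢0 : ∀ d → ι (+ suc d) ≢ 0ℚ
  ι-suc≢0 d eq = contradiction (ι≡0⇒≡0 (+ suc d) eq) λ ()

  +≡0⇒≡- : ∀ p q → p + q ≡ 0ℚ → p ≡ - q
  +≡0⇒≡- p q eq = trans (restore p q) (trans (cong (_+ - q) eq) (+-identityˡ (- q)))
    where
    restore : ∀ p q → p ≡ (p + q) + - q
    restore = solve 2 (λ p q → p := (p :+ q) :+ :- q) refl

  root : ℕ → ℚ
  root j = (ℤ.- decodeℤ (π₂ j)) / suc (π₁ j)

  linear-root : ∀ j {x} → linear j x ≡ 0ℚ → x ≡ root j
  linear-root j {x} eq = *-cancelˡ-≢0 x (root j) (ι-suc≢0 (π₁ j)) (begin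
    ι (+ suc (π₁ j)) * x        ≡⟨ +≡0⇒≡- (ι (+ suc (π₁ j)) * x) (ι (decodeℤ (π₂ j))) eq ⟩
    - ι (decodeℤ (π₂ j))        ≡⟨ ι-neg (decodeℤ (π₂ j)) ⟨
    ι (ℤ.- decodeℤ (π₂ j))      ≡⟨ numerator (ℤ.- decodeℤ (π₂ j)) (π₁ j) ⟨
    ι (+ suc (π₁ j)) * root j   ∎)
    where open ≡-Reasoning

  -- A place where the rational occurs in the enumeration. The numerator is negated because `linear`
  -- adds its constant term.
  index : ℚ → ℕ
  index (mkℚ p d _) = pair d (codeℤ (ℤ.- p))

  linear-index : ∀ x → linear (index x) x ≡ 0ℚ
  linear-index x@(mkℚ p d _) = begin
    ι (+ suc (π₁ (index x))) * x + ι (decodeℤ (π₂ (index x)))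
      ≡⟨ cong₂ (λ a z → ι (+ suc a) * x + ι (decodeℤ z)) (π₁-pair d (codeℤ (ℤ.- p))) (π₂-pair d (codeℤ (ℤ.- p))) ⟩
    ι (+ suc d) * x + ι (decodeℤ (codeℤ (ℤ.- p)))
      ≡⟨ cong₂ _+_ (↧*≡↥ x) (cong ι (codeℤ-injective (decodeℤ (codeℤ (ℤ.- p))) (ℤ.- p) (proj₂ (codeℤ-surjective (codeℤ (ℤ.- p)))))) ⟩
    ι p + ι (ℤ.- p)
      ≡⟨ cong (λ q → ι p + q) (ι-neg p) ⟩
    ι p + - ι p
      ≡⟨ +-inverseʳ (ι p) ⟩
    0ℚ ∎
    where open ≡-Reasoning

  linears≡0⇒root : ∀ N {x} → linears N x ≡ 0ℚ → ∃[ j ] (j ℕ.< N × x ≡ root j)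
  linears≡0⇒root (suc N) {x} eq with *≡0⇒≡0 (linear N x) (linears N x) eq
  ... | inj₁ linear≡0 = N , ℕ.≤-refl , linear-root N linear≡0
  ... | inj₂ linears≡0 with linears≡0⇒root N linears≡0
  ...   | j , j<N , x≡ = j , ℕ.m<n⇒m<1+n j<N , x≡

  linear≡0⇒linears≡0 : ∀ {j N} x → j ℕ.< N → linear j x ≡ 0ℚ → linears N x ≡ 0ℚ
  linear≡0⇒linears≡0 {j} {suc N} x (s≤s j≤N) eq with ℕ.m≤n⇒m<n∨m≡n j≤N
  ... | inj₁ j<N  = trans (cong (linear N x *_) (linear≡0⇒linears≡0 x j<N eq)) (*-zeroʳ (linear N x))
  ... | inj₂ refl = trans (cong (_* linears N x) eq) (*-zeroˡ (linears N x))

  -- Each factor is a positive multiple of M² plus squares, hence positive. The argument works for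
  -- all rational u, v, w, whatever denominators `R` admits.
  form≢0 : ∀ {M} u v w → M ≢ 0ℚ → form M u v w ≢ 0ℚ
  form≢0 {M} u v w M≢0 = positive⇒≢0 (pos*pos⇒pos f {{f>0}} g {{g>0}})
    where
    s = w + w + M
    f = M * M + u * u + v * v
    g = s * s + ι (+ 7) * (M * M)
    M²>0 : Positive (M * M)
    M²>0 = p²-positive M M≢0
    f>0 : Positive f
    f>0 = pos+nonNeg⇒pos (M * M + u * u)
      {{pos+nonNeg⇒pos (M * M) {{M²>0}} (u * u) {{p²-nonNegative u}}}} (v * v) {{p²-nonNegative v}}
    g>0 : Positive g
    g>0 = nonNeg+pos⇒pos (s * s) {{p²-nonNegative s}} (ι (+ 7) * (M * M))
      {{pos*pos⇒pos (ι (+ 7)) (M * M) {{M²>0}}}}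

  -- Homogeneity of degree 4 in M, u, v, w reduces the form on multiples of `M` to integer arguments
  -- with M = 1.
  form-scale : ∀ M u v w → form M (u * M) (v * M) (w * M) ≡
    (M * M * M * M) * ((1ℚ + u * u + v * v) * ((w + w + 1ℚ) * (w + w + 1ℚ) + ι (+ 7)))
  form-scale = solve 4 (λ M u v w →
    (M :* M :+ (u :* M) :* (u :* M) :+ (v :* M) :* (v :* M)) :*
      ((w :* M :+ w :* M :+ M) :* (w :* M :+ w :* M :+ M) :+ con (ι (+ 7)) :* (M :* M)) :=
    (M :* M :* M :* M) :* ((con 1ℚ :+ u :* u :+ v :* v) :*
      ((w :+ w :+ con 1ℚ) :* (w :+ w :+ con 1ℚ) :+ con (ι (+ 7))))) refl

  ι-form : ∀ u v w →
    ι ((ℤ.1ℤ ℤ.+ u ℤ.* u ℤ.+ v ℤ.* v) ℤ.* ((w ℤ.+ w ℤ.+ ℤ.1ℤ) ℤ.* (w ℤ.+ w ℤ.+ ℤ.1ℤ) ℤ.+ + 7)) ≡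
    (1ℚ + ι u * ι u + ι v * ι v) * ((ι w + ι w + 1ℚ) * (ι w + ι w + 1ℚ) + ι (+ 7))
  ι-form u v w = trans (ι-* (ℤ.1ℤ ℤ.+ u ℤ.* u ℤ.+ v ℤ.* v) _) (cong₂ _*_
    (trans (ι-+ (ℤ.1ℤ ℤ.+ u ℤ.* u) (v ℤ.* v)) (cong₂ _+_
      (trans (ι-+ ℤ.1ℤ (u ℤ.* u)) (cong (λ q → 1ℚ + q) (ι-* u u))) (ι-* v v)))
    (trans (ι-+ ((w ℤ.+ w ℤ.+ ℤ.1ℤ) ℤ.* (w ℤ.+ w ℤ.+ ℤ.1ℤ)) (+ 7)) (cong (_+ ι (+ 7))
      (trans (ι-* (w ℤ.+ w ℤ.+ ℤ.1ℤ) (w ℤ.+ w ℤ.+ ℤ.1ℤ)) (cong₂ _*_ 2w+1 2w+1)))))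
    where
    2w+1 : ι (w ℤ.+ w ℤ.+ ℤ.1ℤ) ≡ ι w + ι w + 1ℚ
    2w+1 = trans (ι-+ (w ℤ.+ w) ℤ.1ℤ) (cong (_+ 1ℚ) (ι-+ w w))

  -- Any common strict upper bound of the indices will do; a sum makes the inequalities simpler than
  -- a maximum.
  vectorBound : Vec ℚ n → ℕ
  vectorBound []       = 0
  vectorBound (x ∷ xs) = suc (index x) ℕ.+ vectorBound xs

  index<vectorBound : ∀ (xs : Vec ℚ n) i → index (lookup xs i) ℕ.< vectorBound xs
  index<vectorBound (x ∷ xs) zero    = ℕ.m≤m+n (suc (index x)) (vectorBound xs)
  index<vectorBound (x ∷ xs) (suc i) =
    ℕ.≤-trans (index<vectorBound xs i) (ℕ.m≤n+m (vectorBound xs) (suc (index x)))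

  listBound : List (Vec ℚ n) → ℕ
  listBound []         = 0
  listBound (xs ∷ xss) = vectorBound xs ℕ.+ listBound xss

  vectorBound≤listBound : ∀ {xs : Vec ℚ n} {xss} → xs ∈ xss → vectorBound xs ℕ.≤ listBound xss
  vectorBound≤listBound {xss = ys ∷ xss} (here refl) = ℕ.m≤m+n (vectorBound ys) (listBound xss)
  vectorBound≤listBound {xss = ys ∷ xss} (there xs∈) =
    ℕ.≤-trans (vectorBound≤listBound xs∈) (ℕ.m≤n+m (listBound xss) (vectorBound ys))

  vectorsOver : List ℚ → ∀ n → List (Vec ℚ n)
  vectorsOver qs zero    = [] ∷ []
  vectorsOver qs (suc n) = cartesianProductWith _∷_ qs (vectorsOver qs n)

  ∈-vectorsOver : ∀ {qs} (xs : Vec ℚ n) → (∀ i → lookup xs i ∈ qs) → xs ∈ vectorsOver qs n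
  ∈-vectorsOver []       _  = here refl
  ∈-vectorsOver (x ∷ xs) ∈qs =
    ∈-cartesianProductWith⁺ _∷_ (∈qs zero) (∈-vectorsOver xs (∈qs ∘ suc))

  -- `mu⇓` asks for the first zero together with successor values at all earlier arguments. In `go`,
  -- `l` is the current candidate and `k` its distance to the known zero.
  minimise : ∀ (g : ℕ → ℕ) N → g N ≡ 0 → ∃[ y ] (g y ≡ 0 × ∀ i → i ℕ.< y → ∃[ z ] g i ≡ suc z)
  minimise g N gN≡0 = go N 0 (subst (λ k → g k ≡ 0) (sym (ℕ.+-identityʳ N)) gN≡0) (λ _ ())
    where
    go : ∀ k l → g (k ℕ.+ l) ≡ 0 → (∀ i → i ℕ.< l → ∃[ z ] g i ≡ suc z) →
      ∃[ y ] (g y ≡ 0 × ∀ i → i ℕ.< y → ∃[ z ] g i ≡ suc z)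
    go zero    l eq below = l , eq , below
    go (suc k) l eq below with g l in gl
    ... | zero  = l , gl , below
    ... | suc z = go k (suc l) (subst (λ j → g j ≡ 0) (sym (ℕ.+-suc k l)) eq) below′
      where
      below′ : ∀ i → i ℕ.< suc l → ∃[ z ] g i ≡ suc z
      below′ i (s≤s i≤l) with ℕ.m≤n⇒m<n∨m≡n i≤l
      ... | inj₁ i<l  = below i i<l
      ... | inj₂ refl = z , gl

  -- The reduction to solvability in a fixed ring with a decision procedure

  module Search {ℓ : Level} (R : Pred ℚ ℓ) (subring : IsSubring R) (nonZero : NonZeroRing R)
    (recursive : Recursive (codes (Solvable R))) where

    open IsSubring subring

    R-0 : R 0ℚ
    R-0 = let p , Rp = nonEmpty in subst R (+-inverseʳ p) (+-closed Rp (neg-closed Rp))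

    -- `ι k` itself need not belong to `R`; multiplication by it is repeated addition, followed by
    -- negation if k < 0.
    R-ι* : ∀ k {r} → R r → R (ι k * r)
    R-ι* (+ n) {r} Rr = go n
      where
      go : ∀ n → R (ι (+ n) * r)
      go zero    = subst R (sym (*-zeroˡ r)) R-0
      go (suc n) = subst R (begin
        r + ι (+ n) * r          ≡⟨ cong (_+ ι (+ n) * r) (*-identityˡ r) ⟨
        1ℚ * r + ι (+ n) * r     ≡⟨ *-distribʳ-+ r 1ℚ (ι (+ n)) ⟨
        (1ℚ + ι (+ n)) * r       ≡⟨ cong (_* r) (ι-+ (+ 1) (+ n)) ⟨
        ι (+ suc n) * r          ∎) (+-closed Rr (go n))
        where open ≡-Reasoning
    R-ι* -[1+ n ] {r} Rr = subst R
      (trans (neg-distribˡ-* (ι (+ suc n)) r) (cong (_* r) (sym (ι-neg (+ suc n)))))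
      (neg-closed (R-ι* (+ suc n) Rr))

    -- A numerator is the denominator times the fraction, hence an integer multiple of an element of
    -- `R`.
    M : ℤ
    M = ↥ (proj₁ nonZero)

    ιM≢0 : ι M ≢ 0ℚ
    ιM≢0 ιM≡0 = proj₂ (proj₂ nonZero) (↥p≡0⇒p≡0 (proj₁ nonZero) (ι≡0⇒≡0 M ιM≡0))

    R-M : R (ι M)
    R-M = subst R (↧*≡↥ (proj₁ nonZero)) (R-ι* (↧ (proj₁ nonZero)) (proj₁ (proj₂ nonZero)))

    form-solvable : ∀ t → t ≢ 0ℚ → ∃[ y ] ∃[ u ] ∃[ v ] ∃[ w ]
      ((R y × R u × R v × R w) × y * t ≡ form (ι M) u v w)
    form-solvable t t≢0 with multiple-of-form-ℤ (↥ t) (t≢0 ∘ ↥p≡0⇒p≡0 t)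
    ... | u , v , w , l , eq =
      -- Write t = a/b. Then a l is the value of the form at M = 1, and M⁴ a l = (b l M⁴) t, so y =
      -- b l M⁴. One factor `M` is split off to exhibit y as an integer multiple of an element of
      -- `R`.
      ι k * m , ι u * m , ι v * m , ι w * m ,
      (R-ι* k R-M , R-ι* u R-M , R-ι* v R-M , R-ι* w R-M) , (begin
        ι k * m * t
          ≡⟨ cong (λ q → q * m * t) ι-k ⟩
        ι (↧ t) * ι l * (m * m * m) * m * t
          ≡⟨ regroup (ι (↧ t)) (ι l) m t ⟩
        (m * m * m * m) * ((ι (↧ t) * t) * ι l)
          ≡⟨ cong (λ q → (m * m * m * m) * (q * ι l)) (↧*≡↥ t) ⟩
        (m * m * m * m) * (ι (↥ t) * ι l)
          ≡⟨ cong ((m * m * m * m) *_) (ι-* (↥ t) l) ⟨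
        (m * m * m * m) * ι (↥ t ℤ.* l)
          ≡⟨ cong (λ z → (m * m * m * m) * ι z) eq ⟩
        (m * m * m * m) * ι ((ℤ.1ℤ ℤ.+ u ℤ.* u ℤ.+ v ℤ.* v) ℤ.*
          ((w ℤ.+ w ℤ.+ ℤ.1ℤ) ℤ.* (w ℤ.+ w ℤ.+ ℤ.1ℤ) ℤ.+ + 7))
          ≡⟨ cong ((m * m * m * m) *_) (ι-form u v w) ⟩
        (m * m * m * m) *
          ((1ℚ + ι u * ι u + ι v * ι v) * ((ι w + ι w + 1ℚ) * (ι w + ι w + 1ℚ) + ι (+ 7)))
          ≡⟨ form-scale m (ι u) (ι v) (ι w) ⟨
        form m (ι u * m) (ι v * m) (ι w * m) ∎)
      where
      open ≡-Reasoning
      m = ι M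
      k = ↧ t ℤ.* l ℤ.* (M ℤ.* M ℤ.* M)
      ι-k : ι k ≡ ι (↧ t) * ι l * (m * m * m)
      ι-k = trans (ι-* (↧ t ℤ.* l) (M ℤ.* M ℤ.* M)) (cong₂ _*_ (ι-* (↧ t) l)
        (trans (ι-* (M ℤ.* M) M) (cong (_* m) (ι-* M M))))
      regroup : ∀ b l m t → b * l * (m * m * m) * m * t ≡ (m * m * m * m) * ((b * t) * l)
      regroup = solve 4 (λ b l m t → b :* l :* (m :* m :* m) :* m :* t :=
        (m :* m :* m :* m) :* ((b :* t) :* l)) refl

    query-solvable : ∀ E N i xs → Solution R E xs → linears N (lookup xs i) ≢ 0ℚ →
      Solvable R (query M E N (toℕ i))
    query-solvable (m , D) N i xs (Rxs , D≡0) t≢0 =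
      let y , u , v , w , (Ry , Ru , Rv , Rw) , yt≡form = form-solvable (linears N (lookup xs i)) t≢0
      in y ∷ u ∷ v ∷ w ∷ xs , Ry ∷ Ru ∷ Rv ∷ Rw ∷ Rxs ,
         trans (eval-query y u v w xs M D N i) (sum≡0 D≡0 yt≡form)
      where
      cancel : ∀ f → f + ι -[1+ 0 ] * f ≡ 0ℚ
      cancel = solve 1 (λ f → f :+ con (ι -[1+ 0 ]) :* f := con 0ℚ) refl
      sum≡0 : ∀ {d s f} → d ≡ 0ℚ → s ≡ f →
        d * d + (s + ι -[1+ 0 ] * f) * (s + ι -[1+ 0 ] * f) ≡ 0ℚ
      sum≡0 {s = s} refl refl = cong (λ g → 0ℚ * 0ℚ + g * g) (cancel s)

    query-unsolvable : ∀ E N i → (∀ xs → Solution R E xs → linears N (lookup xs i) ≡ 0ℚ) →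
      ¬ Solvable R (query M E N (toℕ i))
    query-unsolvable (m , D) N i vanishes (y ∷ u ∷ v ∷ w ∷ xs , _ ∷ _ ∷ _ ∷ _ ∷ Rxs , eval≡0) =
      form≢0 u v w ιM≢0 (begin
        -- Writing f as y 0 - (y 0 - f) lets the inner 0 be replaced by `t`, which turns the bracket
        -- into `gap`.
        f                                    ≡⟨ restore f y ⟩
        y * 0ℚ + - (y * 0ℚ + ι -[1+ 0 ] * f) ≡⟨ cong (λ t → y * 0ℚ + - (y * t + ι -[1+ 0 ] * f)) t≡0 ⟨
        y * 0ℚ + - (y * t + ι -[1+ 0 ] * f)  ≡⟨ cong (λ g → y * 0ℚ + - g) (p²+q²≡0⇒q≡0 (eval D xs) gap sum≡0) ⟩
        y * 0ℚ + - 0ℚ                        ≡⟨ cong (_+ - 0ℚ) (*-zeroʳ y) ⟩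
        0ℚ                                   ∎)
      where
      open ≡-Reasoning
      t = linears N (lookup xs i)
      f = form (ι M) u v w
      gap = y * t + ι -[1+ 0 ] * f
      sum≡0 : eval D xs * eval D xs + gap * gap ≡ 0ℚ
      sum≡0 = trans (sym (eval-query y u v w xs M D N i)) eval≡0
      t≡0 : t ≡ 0ℚ
      t≡0 = vanishes xs (Rxs , p²+q²≡0⇒p≡0 (eval D xs) gap sum≡0)
      restore : ∀ f y → f ≡ y * 0ℚ + - (y * 0ℚ + ι -[1+ 0 ] * f)
      restore = solve 2 (λ f y →
        f := y :* con 0ℚ :+ :- (y :* con 0ℚ :+ con (ι -[1+ 0 ]) :* f)) refl

    solvable? : ∀ E → Dec (Solvable R E)
    solvable? E with proj₂ recursive (code E)
    ... | inj₁ ((E′ , eq , solvable) , _) = yes (subst (Solvable R) (code-injective E′ E eq) solvable)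
    ... | inj₂ (¬codes , _) = no (λ solvable → ¬codes (E , refl , solvable))

    decide : ℕ → ℕ
    decide x = [ (λ _ → 1) , (λ _ → 0) ]′ (proj₂ recursive x)

    decideᶜ : ∀ {F : Vec ℕ n → ℕ} → Computable F → Computable (λ xs → decide (F xs))
    decideᶜ {F = F} f = ≗-computable (program₁ [ f ∷ˢ []ˢ ]ᶜ) (λ _ → refl)
      where
      program₁ : Computable {1} (λ xs → decide (lookup xs zero))
      program₁ = computedBy (proj₁ recursive) λ where (x ∷ []) → correct₁ x
        where
        correct₁ : ∀ x → proj₁ recursive [ x ∷ [] ]⇓ decide x
        correct₁ x with proj₂ recursive x
        ... | inj₁ (_ , ⇓1) = ⇓1
        ... | inj₂ (_ , ⇓0) = ⇓0

    unsolvable⇒decide≡0 : ∀ E → ¬ Solvable R E → decide (code E) ≡ 0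
    unsolvable⇒decide≡0 E unsolvable with proj₂ recursive (code E)
    ... | inj₁ ((E′ , eq , solvable) , _) =
      contradiction (subst (Solvable R) (code-injective E′ E eq) solvable) unsolvable
    ... | inj₂ _ = refl

    decide≡0⇒unsolvable : ∀ E → decide (code E) ≡ 0 → ¬ Solvable R E
    decide≡0⇒unsolvable E eq solvable with proj₂ recursive (code E)
    ... | inj₁ _ = contradiction eq λ ()
    ... | inj₂ (¬codes , _) = ¬codes (E , refl , solvable)

    R? : ∀ q → Dec (R q)
    R? q@(mkℚ p d _) = map′ to from (solvable? E)
      where
      D : Polynomial 1
      D = addP (mulP (constP (+ suc d)) (varP 0)) (constP (ℤ.- p))
      E : Equation
      E = 0 , D
      eval-D : ∀ x → eval D (x ∷ []) ≡ ι (+ suc d) * x + ι (ℤ.- p)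
      eval-D x = eval-add-≡ (x ∷ [])
        (eval-mul-≡ (x ∷ []) (eval-const (x ∷ []) (+ suc d)) (eval-var (x ∷ []) zero))
        (eval-const (x ∷ []) (ℤ.- p))
      to : Solvable R E → R q
      to (x ∷ [] , Rx ∷ [] , eq) = subst R (*-cancelˡ-≢0 x q (ι-suc≢0 d) (begin
        ι (+ suc d) * x    ≡⟨ +≡0⇒≡- (ι (+ suc d) * x) (ι (ℤ.- p)) (trans (sym (eval-D x)) eq) ⟩
        - ι (ℤ.- p)        ≡⟨ ι-neg (ℤ.- p) ⟨
        ι (ℤ.- (ℤ.- p))    ≡⟨ cong ι (ℤ.neg-involutive p) ⟩
        ι p                ≡⟨ ↧*≡↥ q ⟨
        ι (+ suc d) * q    ∎)) Rx
        where open ≡-Reasoning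
      from : R q → Solvable R E
      from Rq = q ∷ [] , Rq ∷ [] , (begin
        eval D (q ∷ [])                ≡⟨ eval-D q ⟩
        ι (+ suc d) * q + ι (ℤ.- p)    ≡⟨ cong₂ _+_ (↧*≡↥ q) (ι-neg p) ⟩
        ι p + - ι p                    ≡⟨ +-inverseʳ (ι p) ⟩
        0ℚ                             ∎)
        where open ≡-Reasoning

    solution? : ∀ E xs → Dec (Solution R E xs)
    solution? (m , D) xs = All.all? R? xs ×-dec (eval D xs ≟ 0ℚ)

    Bounded : Equation → ℕ → Set ℓ
    Bounded E N = ∀ (i : Fin (suc (proj₁ E))) → ¬ Solvable R (query M E N (toℕ i))

    finite⇒bounded : ∀ E → FinitelyManySolutions R E → ∃ (Bounded E)
    finite⇒bounded E (xss , ∈⇔) = listBound xss , λ i →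
      query-unsolvable E (listBound xss) i λ xs solution →
        linear≡0⇒linears≡0 (lookup xs i)
          (ℕ.≤-trans (index<vectorBound xs i)
            (vectorBound≤listBound (Equivalence.from (∈⇔ xs) solution)))
          (linear-index (lookup xs i))

    bounded⇒finite : ∀ E N → Bounded E N → FinitelyManySolutions R E
    bounded⇒finite E N bounded = filter (solution? E) box , λ xs → mk⇔
      (λ xs∈ → proj₂ (∈-filter⁻ (solution? E) {xs = box} xs∈))
      (λ solution → ∈-filter⁺ (solution? E) (∈-vectorsOver xs (in-box xs solution)) solution)
      where
      roots : List ℚ
      roots = map root (upTo N)
      box : List (Vec ℚ (suc (proj₁ E)))
      box = vectorsOver roots (suc (proj₁ E))
      in-box : ∀ xs → Solution R E xs → ∀ i → lookup xs i ∈ roots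
      -- `bounded` only refutes a non-zero value; decidable equality in ℚ turns this into a zero,
      -- hence into one of the first `N` roots.
      in-box xs solution i with linears N (lookup xs i) ≟ 0ℚ
      ... | no  t≢0 = contradiction (query-solvable E N i xs solution t≢0) (bounded i)
      ... | yes t≡0 with linears≡0⇒root N t≡0
      ...   | j , j<N , x≡ = subst (_∈ roots) (sym x≡) (∈-map⁺ root (∈-upTo⁺ j<N))

    -- The number of coordinates that some solution takes outside the first `N` rationals. For
    -- `x = code E`, `suc (π₁ x)` is the number of variables. A sum of 0/1 answers merges all
    -- queries into one value, as `muᵣ` looks for a zero.
    test : ℕ → ℕ → ℕ
    test N x = primrec 0 (λ i r → r ℕ.+ decide (queryℂ (codeℤ M) x N i)) (suc (π₁ x))

    testᶜ : Computable {2} (λ xs → test (lookup xs (# 0)) (lookup xs (# 1)))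
    testᶜ = primrecᶜ (constᶜ 0)
      -- The variables are, in order, the counter `i`, the accumulator `r`, then `N` and `x`.
      (varᶜ (# 1) +ᶜ decideᶜ (queryℂᶜ (codeℤ M) (varᶜ (# 3)) (varᶜ (# 2)) (varᶜ (# 0))))
      (sucᶜ (π₁ᶜ (varᶜ (# 1))))

    sum≡0⇒≡0 : ∀ (g : ℕ → ℕ) k → primrec 0 (λ i r → r ℕ.+ g i) k ≡ 0 → ∀ i → i ℕ.< k → g i ≡ 0
    sum≡0⇒≡0 g (suc k) eq i (s≤s i≤k) with ℕ.m≤n⇒m<n∨m≡n i≤k
    ... | inj₁ i<k  = sum≡0⇒≡0 g k (ℕ.m+n≡0⇒m≡0 _ eq) i i<k
    ... | inj₂ refl = ℕ.m+n≡0⇒n≡0 (primrec 0 (λ i r → r ℕ.+ g i) k) eq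

    ≡0⇒sum≡0 : ∀ (g : ℕ → ℕ) k → (∀ i → i ℕ.< k → g i ≡ 0) → primrec 0 (λ i r → r ℕ.+ g i) k ≡ 0
    ≡0⇒sum≡0 g zero    _   = refl
    ≡0⇒sum≡0 g (suc k) g≡0 = cong₂ ℕ._+_
      (≡0⇒sum≡0 g k (λ i i<k → g≡0 i (ℕ.m<n⇒m<1+n i<k))) (g≡0 k ℕ.≤-refl)

    test≡0⇒bounded : ∀ E N → test N (code E) ≡ 0 → Bounded E N
    test≡0⇒bounded E@(m , D) N eq i = decide≡0⇒unsolvable (query M E N (toℕ i))
      (trans (cong decide (sym (queryℂ-correct M E N (toℕ i))))
        (sum≡0⇒≡0 (λ i → decide (queryℂ (codeℤ M) (code E) N i)) (suc (π₁ (code E))) eq (toℕ i)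
          (subst (λ k → toℕ i ℕ.< suc k) (sym (π₁-pair m (codePolynomial D))) (toℕ<n i))))

    bounded⇒test≡0 : ∀ E N → Bounded E N → test N (code E) ≡ 0
    bounded⇒test≡0 E@(m , D) N bounded =
      ≡0⇒sum≡0 (λ i → decide (queryℂ (codeℤ M) (code E) N i)) (suc (π₁ (code E))) λ i i<k →
        let i<1+m = subst (λ k → i ℕ.< suc k) (π₁-pair m (codePolynomial D)) i<k
        in trans (cong decide (queryℂ-correct M E N i))
          (unsolvable⇒decide≡0 (query M E N i)
            (subst (λ i → ¬ Solvable R (query M E N i)) (toℕ-fromℕ< i<1+m) (bounded (fromℕ< i<1+m))))

    enumerable : RecursivelyEnumerable (codes (FinitelyManySolutions R))
    enumerable = muᵣ (program testᶜ) , λ x → mk⇔ (halts x) (λ (y , ⇓y) → finite x y ⇓y)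
      where
      halts : ∀ x → codes (FinitelyManySolutions R) x → ∃[ y ] muᵣ (program testᶜ) [ x ∷ [] ]⇓ y
      halts x (E , refl , fin) =
        let N , bounded = finite⇒bounded E fin
            y , test≡0 , below = minimise (λ N → test N (code E)) N (bounded⇒test≡0 E N bounded)
            run : ∀ {k v} → test k x ≡ v → program testᶜ [ k ∷ x ∷ [] ]⇓ v
            run {k} eq = subst (program testᶜ [ k ∷ x ∷ [] ]⇓_) eq (correct testᶜ (k ∷ x ∷ []))
        in y , mu⇓ (run test≡0) (λ i i<y → proj₁ (below i i<y) , run (proj₂ (below i i<y)))
      finite : ∀ x y → muᵣ (program testᶜ) [ x ∷ [] ]⇓ y → codes (FinitelyManySolutions R) x
      finite x y (mu⇓ ⇓0 _) with code-surjective x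
      ... | E , refl = E , refl , bounded⇒finite E y
        (test≡0⇒bounded E y (⇓-deterministic (correct testᶜ (y ∷ code E ∷ [])) ⇓0))

theorem1 : {ℓ : Level} (R : Pred ℚ ℓ) → IsSubring R → NonZeroRing R →
    Recursive (codes (Solvable R)) →
    RecursivelyEnumerable (codes (FinitelyManySolutions R))
theorem1 = Finiteness.Search.enumerable
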